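{- Let $\mathbf{k}$ be a commutative ring, $q\in\mathbf{k}$, $\pi\in S_n$ and $\alpha$ a composition with $n$ entries. Then \[U^q_{\pi,\alpha}=\sum_{\substack{I\subseteq\operatorname{Des}(\pi)\\ J\subseteq\operatorname{Peak}(\pi)\\ I\cap J=\emptyset}}(-q)^{|J|}(q-1)^{|I|}\,\eta^{(q)}_{\alpha^{\downarrow I\downarrow\downarrow J}}.\]
   Context: Let $x_1,x_2,\dots$ be commuting indeterminates, working in $\mathbf{k}[[x_1,x_2,\dots]]$. Let $\mathbb{P}=\{1,2,\dots\}$ and $\mathbb{P}^{\pm}=\mathbb{P}\cup(-\mathbb{P})$ totally ordered by $-1<1<-2<2<\cdots$. For a partial order $<_P$ on $[n]$, an enriched $P$-partition is a map $f:[n]\to\mathbb{P}^{\pm}$ such that (i) if $i<_P j$ and $i<j$ then $f(i)<f(j)$ or $f(i)=f(j)\in\mathbb{P}$; (ii) if $i<_P j$ and $i>j$ then $f(i)<f(j)$ or $f(i)=f(j)\in-\mathbb{P}$. For $\pi=\pi_1\cdots\pi_n\in S_n$ and a composition (sequence of positive integers) $\alpha=(\alpha_1,\dots,\alpha_n)$, let $<_\pi$ be the total order $\pi_1<_\pi\cdots<_\pi\pi_n$ and $\epsilon(\pi_i)=\alpha_i$; set $U^q_{\pi,\alpha}=\sum_f\prod_{i=1}^n q^{[f(i)<0]}x_{|f(i)|}^{\epsilon(i)}$ over enriched $P$-partitions $f$ for $<_\pi$, where $[f(i)<0]\in\{0,1\}$ indicates negativity. For a composition $\beta$ with $k$ entries,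 $\eta^{(q)}_\beta=U^q_{id_k,\beta}$ with $id_k=12\cdots k$; equivalently $\eta^{(q)}_\beta=\sum_{i_1\le\cdots\le i_k}(q+1)^{|\{i_1,\dots,i_k\}|}x_{i_1}^{\beta_1}\cdots x_{i_k}^{\beta_k}$. $\operatorname{Des}(\pi)=\{1\le i\le n-1:\pi(i)>\pi(i+1)\}$, $\operatorname{Peak}(\pi)=\{2\le i\le n-1:\pi(i-1)<\pi(i)>\pi(i+1)\}$. A subset of $[n-1]$ is peak-lacunar if it contains neither $1$ nor two consecutive integers. For $1\le i\le n-1$, $\alpha^{\downarrow i}=(\alpha_1,\dots,\alpha_{i-1},\alpha_i+\alpha_{i+1},\alpha_{i+2},\dots,\alpha_n)$; for $I=\{i_1<\cdots<i_k\}\subseteq[n-1]$, $\alpha^{\downarrow I}=((\cdots(\alpha^{\downarrow i_k})\cdots)^{\downarrow i_2})^{\downarrow i_1}$. For $I,J\subseteq[n-1]$ with $J$ peak-lacunar, $\alpha^{\downarrow I\downarrow\downarrow J}=\alpha^{\downarrow K}$ with $K=I\cup J\cup(J-1)$, where $J-1=\{j-1:j\in J\}$. -}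

module Defs where

open import Level using (Level)
open import Data.Bool using (Bool; true; false; if_then_else_; _∧_; _∨_; not)
open import Data.Nat as ℕ using (ℕ; zero; suc; _∸_; _<?_; _≡ᵇ_)
open import Data.Fin as Fin using (Fin; toℕ; fromℕ<)
open import Data.Fin.Properties using (all?)
open import Data.Fin.Permutation using (Permutation′; _⟨$⟩ʳ_; _⟨$⟩ˡ_)
open import Data.List as List using (List; []; _∷_; map; concatMap; filterᵇ; upTo; foldr; length)
open import Data.Bool.ListAction using (any)
open import Data.Vec as Vec using (Vec; []; _∷_; lookup; tabulate)
import Data.Vec.Properties as VecP
open import Data.Product using (_×_; _,_)
open import Data.Sum using (_⊎_)
open import Data.Unit using (⊤; tt)
open import Data.Empty using (⊥)
open import Relation.Nullary using (Dec; yes; no; does)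
open import Relation.Nullary.Decidable.Core using (_×-dec_; _⊎-dec_; _→-dec_)
open import Relation.Binary.PropositionalEquality using (_≡_; refl)
open import Algebra.Bundles using (CommutativeRing)

-- The totally ordered set ℙ^± = ℙ ∪ (−ℙ), with −1 < 1 < −2 < 2 < ⋯

data ℙ± : Set where
  pos : ℕ → ℙ±   -- pos k  is the positive integer  k+1
  neg : ℕ → ℙ±   -- neg k  is the negative integer −(k+1)

-- position in the order −1 < 1 < −2 < 2 < ⋯
key : ℙ± → ℕ
key (neg k) = 2 ℕ.* k
key (pos k) = suc (2 ℕ.* k)

_<±_ : ℙ± → ℙ± → Set
x <± y = key x ℕ.< key y

-- |v| − 1, i.e. the (0-based) index of the variable x_{|v|}
absIdx : ℙ± → ℕ
absIdx (pos k) = k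
absIdx (neg k) = k

IsPos : ℙ± → Set
IsPos (pos _) = ⊤
IsPos (neg _) = ⊥

IsNeg : ℙ± → Set
IsNeg (pos _) = ⊥
IsNeg (neg _) = ⊤

isNegᵇ : ℙ± → Bool
isNegᵇ (pos _) = false
isNegᵇ (neg _) = true

IsPos? : ∀ x → Dec (IsPos x)
IsPos? (pos _) = yes tt
IsPos? (neg _) = no (λ ())

IsNeg? : ∀ x → Dec (IsNeg x)
IsNeg? (pos _) = no (λ ())
IsNeg? (neg _) = yes tt

_≟±_ : (x y : ℙ±) → Dec (x ≡ y)
pos a ≟± pos b with a ℕ.≟ b
... | yes refl = yes refl
... | no ¬p = no (λ { refl → ¬p refl })
neg a ≟± neg b with a ℕ.≟ b
... | yes refl = yes refl
... | no ¬p = no (λ { refl → ¬p refl })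
pos _ ≟± neg _ = no (λ ())
neg _ ≟± pos _ = no (λ ())

_<±?_ : ∀ x y → Dec (x <± y)
x <±? y = key x <? key y

-- Enriched P-partitions of a poset (P = [n], encoded as Fin n, with
-- the usual order of [n] being the order of Fin n)

EnrichedPP : {n : ℕ} → (Fin n → Fin n → Set) → (Fin n → ℙ±) → Set
EnrichedPP _<P_ f =
  ∀ i j → i <P j →
    ((toℕ i ℕ.< toℕ j → (f i <± f j) ⊎ ((f i ≡ f j) × IsPos (f i)))
   × (toℕ j ℕ.< toℕ i → (f i <± f j) ⊎ ((f i ≡ f j) × IsNeg (f i))))

enriched? : {n : ℕ} (_<P_ : Fin n → Fin n → Set) →
            (∀ i j → Dec (i <P j)) → (f : Fin n → ℙ±) → Dec (EnrichedPP _<P_ f)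
enriched? _<P_ _<P?_ f =
  all? λ i → all? λ j →
    (i <P? j) →-dec
      (((toℕ i <? toℕ j) →-dec ((f i <±? f j) ⊎-dec ((f i ≟± f j) ×-dec IsPos? (f i))))
       ×-dec
       ((toℕ j <? toℕ i) →-dec ((f i <±? f j) ⊎-dec ((f i ≟± f j) ×-dec IsNeg? (f i)))))

-- The total order <_π :  π₁ <_π π₂ <_π ⋯ <_π πₙ,
-- where π ⟨$⟩ʳ i = π_{i+1} (one-line notation, 0-based positions)
_<[_]_ : {n : ℕ} → Fin n → Permutation′ n → Fin n → Set
a <[ π ] b = toℕ (π ⟨$⟩ˡ a) ℕ.< toℕ (π ⟨$⟩ˡ b)

allVecs : {A : Set} → List A → (n : ℕ) → List (Vec A n)
allVecs xs zero = [] ∷ []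
allVecs xs (suc n) = concatMap (λ x → map (x ∷_) (allVecs xs n)) xs

valsUpTo : ℕ → List ℙ±
valsUpTo N = concatMap (λ k → neg k ∷ pos k ∷ []) (upTo N)

-- all subsequences (= subsets, when the list is strictly increasing)
sublists : {A : Set} → List A → List (List A)
sublists [] = [] ∷ []
sublists (x ∷ xs) = sublists xs List.++ map (x ∷_) (sublists xs)

-- Formal power series in x₁, x₂, … over a commutative ring, represented
-- by their coefficients: a series assigns to every N and every exponent
-- vector e ∈ ℕ^N the coefficient of the monomial x₁^{e₁}⋯x_N^{e_N}.

module _ {c ℓ : Level} (R : CommutativeRing c ℓ) where
  open CommutativeRing R

  Series : Set c
  Series = (N : ℕ) → Vec ℕ N → Carrier

  _≈ₛ_ : Series → Series → Set ℓ
  F ≈ₛ G = ∀ N e → F N e ≈ G N e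

  sumR : List Carrier → Carrier
  sumR = foldr _+_ 0#

  powR : Carrier → ℕ → Carrier
  powR x zero = 1#
  powR x (suc k) = x * powR x k

  _·ₛ_ : Carrier → Series → Series
  (a ·ₛ F) N e = a * F N e

  sumₛ : List Series → Series
  sumₛ Fs N e = sumR (map (λ F → F N e) Fs)

  -- U^q_{π,α} = Σ_f ∏_i q^{[f(i)<0]} x_{|f(i)|}^{ε(i)}, f enriched P-partition
  -- for <_π and ε(π_i) = α_i.  Its coefficient of x₁^{e₁}⋯x_N^{e_N} is the
  -- sum of q^{#negative values} over those f whose monomial is exactly
  -- that one (necessarily |f(i)| ≤ N for all i since α has positive parts).
  U : Carrier → {n : ℕ} → Permutation′ n → Vec ℕ n → Series
  U q {n} π α N e = sumR (map term (allVecs (valsUpTo N) n))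
    where
    ε : Fin n → ℕ
    ε a = lookup α (π ⟨$⟩ˡ a)
    term : Vec ℙ± n → Carrier
    term v =
      let f = lookup v
          mono : Vec ℕ N
          mono = tabulate λ k → Vec.sum (tabulate λ a →
                   if absIdx (f a) ≡ᵇ toℕ k then ε a else 0)
          negs = Vec.sum (tabulate λ a → if isNegᵇ (f a) then 1 else 0)
      in if does (enriched? (λ a b → a <[ π ] b)
                    (λ a b → toℕ (π ⟨$⟩ˡ a) <? toℕ (π ⟨$⟩ˡ b)) f)
            ∧ does (VecP.≡-dec ℕ._≟_ mono e)
         then powR q negs else 0#

  η : Carrier → List ℕ → Series
  η q β = U q Data.Fin.Permutation.id (Vec.fromList β)

-- Descents and peaks (1-based positions)

-- π(i) for 1 ≤ i ≤ n, as a number in 1..n (0 outside that range)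
oneLine : {n : ℕ} → Permutation′ n → ℕ → ℕ
oneLine π zero = 0
oneLine {n} π (suc j) with j <? n
... | yes p = suc (toℕ (π ⟨$⟩ʳ fromℕ< p))
... | no _ = 0

range1 : ℕ → List ℕ
range1 n = map suc (upTo (n ∸ 1))

Des : {n : ℕ} → Permutation′ n → List ℕ
Des {n} π = filterᵇ (λ i → oneLine π (suc i) ℕ.<ᵇ oneLine π i) (range1 n)

Peak : {n : ℕ} → Permutation′ n → List ℕ
Peak {n} π = filterᵇ (λ i → (2 ℕ.≤ᵇ i) ∧ (oneLine π (i ∸ 1) ℕ.<ᵇ oneLine π i)
                                      ∧ (oneLine π (suc i) ℕ.<ᵇ oneLine π i))
                     (range1 n)

_∈ᵇ_ : ℕ → List ℕ → Bool
i ∈ᵇ xs = any (i ≡ᵇ_) xs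

disjointᵇ : List ℕ → List ℕ → Bool
disjointᵇ I J = not (any (_∈ᵇ J) I)

-- α^{↓i}  (1-based i)
_↓_ : List ℕ → ℕ → List ℕ
(a ∷ b ∷ r) ↓ 1 = (a ℕ.+ b) ∷ r
(a ∷ r) ↓ suc (suc i) = a ∷ (r ↓ suc i)
α ↓ _ = α

-- α^{↓I} for I = {i₁ < ⋯ < i_k} given as increasing list:
-- ((⋯(α^{↓i_k})⋯)^{↓i₂})^{↓i₁}
_↓set_ : List ℕ → List ℕ → List ℕ
α ↓set I = foldr (λ i β → β ↓ i) α I

_↓_↓↓_ : List ℕ → List ℕ → List ℕ → List ℕ
α ↓ I ↓↓ J =
  α ↓set filterᵇ (λ i → (i ∈ᵇ I) ∨ (i ∈ᵇ J) ∨ (suc i ∈ᵇ J)) (range1 (length α))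

DesPeakPairs : {n : ℕ} → Permutation′ n → List (List ℕ × List ℕ)
DesPeakPairs π =
  filterᵇ (λ { (I , J) → disjointᵇ I J })
    (concatMap (λ I → map (I ,_) (sublists (Peak π))) (sublists (Des π)))

{-# OPTIONS --safe #-}
module Submission where

-- Read an enriched P-partition along π and group by h = |f|, a weakly increasing
-- sequence.  On a block where h is constant the negative values come first, at
-- descents, and the positive ones after, at ascents; so the signs contribute
-- (1 + q) q^(number of descents inside the block) if the block has no interior
-- peak, and 0 otherwise.  On the right, η of a merged composition is the sum of
-- (1 + q)^(number of blocks of h) over the h that are constant across the merged
-- positions.  For fixed h the sum over (I , J) is therefore a product over
-- positions, whose factor is q at a descent inside a block, 1 + (q - 1) - q = 0
-- if that descent is moreover an interior peak, and 1 elsewhere.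

-- An interior peak involves two neighbouring steps, so weights attached to single steps cannot
-- describe the sign count. The recursions therefore carry one Boolean (the preceding step was an
-- equality at an ascent). It is forgotten after one further step, which is what makes the weight a
-- product of local factors. The pairs (I , J) can produce such factors because a position in J asks
-- for equality there and also just before it, as J - 1 is merged too. The constants are then
-- forced: a descent inside a block must weigh q, so I carries q - 1; at an interior peak the total
-- must vanish, so J carries -q. The formula for η needs no separate argument: η is U of the
-- identity, so it comes from the same expansion in the absence of descents. Series are compared
-- coefficient by coefficient, and the test for the wanted monomial stays an arbitrary function of
-- the exponent vector, so that an induction on the length can absorb the first variable into it.

open import Defs
open import Level using (Level)
open import Algebra.Bundles using (CommutativeRing)
open import Data.Bool using (Bool; true; false; T; if_then_else_; _∧_; _∨_; not)
open import Data.Bool.ListAction using (all)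
open import Data.Bool.Properties using (T-∧; T-∨; not-injective)
open import Data.Fin as Fin using (Fin; toℕ; fromℕ<; punchIn; punchOut)
open import Data.Fin.Permutation as Perm using (Permutation′; _⟨$⟩ʳ_; _⟨$⟩ˡ_)
open import Data.Fin.Properties using (toℕ<n; toℕ-injective; toℕ-fromℕ<; fromℕ<-toℕ; punchIn-punchOut)
open import Data.List as List using (List; []; _∷_; map; length; filterᵇ; concatMap; upTo; applyUpTo)
open import Data.List.Membership.Propositional using (_∈_)
open import Data.List.Properties using (map-applyUpTo; map-upTo)
import Data.List.Relation.Unary.All as Allₗ
open Allₗ using ([]; _∷_)
open import Data.List.Relation.Unary.All.Properties using (++⁺; map⁺; filter⁺; all-upTo; all⁺; all⁻)
open import Data.List.Relation.Unary.AllPairs using ([]; _∷_)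
import Data.List.Relation.Unary.Any as Any
open import Data.List.Relation.Unary.Any.Properties using (any⁺; any⁻)
open import Data.List.Relation.Unary.Unique.Propositional using (Unique)
import Data.List.Relation.Unary.Unique.Propositional.Properties as Unique
open import Data.Nat as ℕ using (ℕ; zero; suc; _≤_; _<ᵇ_; _≡ᵇ_; _∸_; z<s; s<s; z≤n; s≤s)
import Data.Nat.Properties as ℕₚ
open import Algebra.Properties.CommutativeMonoid.Sum ℕₚ.+-0-commutativeMonoid as ℕΣ using ()
open import Data.Product using (_×_; _,_; proj₁; proj₂)
open import Data.Sum using (_⊎_; inj₁; inj₂; [_,_]′)
open import Data.Unit using (tt)
open import Data.Vec as Vec using (Vec; []; _∷_; lookup; tabulate; toList; fromList; replicate; zipWith; insertAt)
import Data.Vec.Properties as Vecₚ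
open import Data.Vec.Relation.Unary.All using (All)
open import Function using (_∘_; _⇔_; mk⇔; Equivalence)
open import Relation.Binary.Definitions using (tri<; tri≈; tri>)
open import Relation.Binary.PropositionalEquality as ≡ using (_≡_; _≢_; cong; cong₂; subst; subst₂)
open import Relation.Nullary using (¬_; contradiction; yes; no; does)
open import Relation.Nullary.Decidable using (does-⇔; T?)
open Equivalence using (to; from)

-- Enriched partitions as chains

-- The condition that an enriched partition imposes on values x, y at labels
-- s <_P t, stated without implications so that it is transitive.
Rel : ℕ → ℙ± → ℕ → ℙ± → Set
Rel s x t y = (x <± y) ⊎ ((x ≡ y × IsPos x × s ℕ.< t) ⊎ (x ≡ y × IsNeg x × t ℕ.< s))

Rel-trans : ∀ {s x t y u z} → Rel s x t y → Rel t y u z → Rel s x u z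
Rel-trans (inj₁ x<y) (inj₁ y<z) = inj₁ (ℕₚ.<-trans x<y y<z)
Rel-trans (inj₁ x<y) (inj₂ (inj₁ (≡.refl , _))) = inj₁ x<y
Rel-trans (inj₁ x<y) (inj₂ (inj₂ (≡.refl , _))) = inj₁ x<y
Rel-trans (inj₂ (inj₁ (≡.refl , _))) (inj₁ y<z) = inj₁ y<z
Rel-trans (inj₂ (inj₂ (≡.refl , _))) (inj₁ y<z) = inj₁ y<z
Rel-trans (inj₂ (inj₁ (≡.refl , p , s<t))) (inj₂ (inj₁ (≡.refl , _ , t<u))) =
  inj₂ (inj₁ (≡.refl , p , ℕₚ.<-trans s<t t<u))
Rel-trans (inj₂ (inj₂ (≡.refl , p , t<s))) (inj₂ (inj₂ (≡.refl , _ , u<t))) =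
  inj₂ (inj₂ (≡.refl , p , ℕₚ.<-trans u<t t<s))
Rel-trans {x = pos _} (inj₂ (inj₁ (≡.refl , _))) (inj₂ (inj₂ (≡.refl , () , _)))
Rel-trans {x = neg _} (inj₂ (inj₂ (≡.refl , _))) (inj₂ (inj₁ (≡.refl , () , _)))

-- δ tells whether the step is a descent.
step : Bool → ℙ± → ℙ± → Bool
step δ (pos k) (neg l) = k <ᵇ l
step δ (pos k) (pos l) = (k <ᵇ l) ∨ (not δ ∧ (k ≡ᵇ l))
step δ (neg k) (neg l) = (k <ᵇ l) ∨ (δ ∧ (k ≡ᵇ l))
step δ (neg k) (pos l) = (k <ᵇ l) ∨ (k ≡ᵇ l)

module _ (k l : ℕ) where
  2*-mono : k ℕ.< l → 2 ℕ.* k ℕ.< 2 ℕ.* l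
  2*-mono = ℕₚ.*-monoʳ-< 2

  2*-cancel : 2 ℕ.* k ℕ.< 2 ℕ.* l → k ℕ.< l
  2*-cancel = ℕₚ.*-cancelˡ-< 2 k l

  2*-suc-mono : k ℕ.< l → suc (2 ℕ.* k) ℕ.< 2 ℕ.* l
  2*-suc-mono k<l = ℕₚ.<-≤-trans (ℕₚ.n<1+n (suc (2 ℕ.* k)))
    (ℕₚ.≤-trans (ℕₚ.≤-reflexive (≡.sym (ℕₚ.*-suc 2 k))) (ℕₚ.*-monoʳ-≤ 2 k<l))

  2*-suc-cancel : 2 ℕ.* k ℕ.< suc (2 ℕ.* l) → k ℕ.≤ l
  2*-suc-cancel p = ℕₚ.*-cancelˡ-≤ 2 (ℕₚ.m<1+n⇒m≤n p)

T-not⇒≮ : ∀ {s t} → T (not (t <ᵇ s)) → ¬ (t ℕ.< s)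
T-not⇒≮ {s} {t} p t<s with t <ᵇ s | ℕₚ.<⇒<ᵇ t<s
T-not⇒≮ () t<s | true | _

≮⇒T-not : ∀ {s t} → s ℕ.< t → T (not (t <ᵇ s))
≮⇒T-not {s} {t} s<t with t <ᵇ s in eq
... | false = tt
... | true  = contradiction s<t (ℕₚ.<⇒≯ (ℕₚ.<ᵇ⇒< t s (subst T (≡.sym eq) tt)))

step⇒Rel : ∀ {s t} x y → s ≢ t → T (step (t <ᵇ s) x y) → Rel s x t y
step⇒Rel (pos k) (neg l) s≢t p = inj₁ (2*-suc-mono k l (ℕₚ.<ᵇ⇒< k l p))
step⇒Rel {s} {t} (pos k) (pos l) s≢t p with to (T-∨ {k <ᵇ l}) p
... | inj₁ k<l = inj₁ (s<s (2*-mono k l (ℕₚ.<ᵇ⇒< k l k<l)))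
-- The failure of `t <ᵇ s` yields only s ≤ t; distinct labels make it strict.
... | inj₂ r with δ , k≡l ← to (T-∧ {not (t <ᵇ s)}) r =
  inj₂ (inj₁ (cong pos (ℕₚ.≡ᵇ⇒≡ k l k≡l) , tt , ℕₚ.≤∧≢⇒< (ℕₚ.≮⇒≥ (T-not⇒≮ δ)) s≢t))
step⇒Rel {s} {t} (neg k) (neg l) s≢t p with to (T-∨ {k <ᵇ l}) p
... | inj₁ k<l = inj₁ (2*-mono k l (ℕₚ.<ᵇ⇒< k l k<l))
... | inj₂ r with δ , k≡l ← to (T-∧ {t <ᵇ s}) r =
  inj₂ (inj₂ (cong neg (ℕₚ.≡ᵇ⇒≡ k l k≡l) , tt , ℕₚ.<ᵇ⇒< t s δ))
step⇒Rel (neg k) (pos l) s≢t p with to (T-∨ {k <ᵇ l}) p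
... | inj₁ k<l = inj₁ (ℕₚ.<-trans (2*-mono k l (ℕₚ.<ᵇ⇒< k l k<l)) (ℕₚ.n<1+n _))
... | inj₂ k≡l rewrite ℕₚ.≡ᵇ⇒≡ k l k≡l = inj₁ (ℕₚ.n<1+n _)

Rel⇒step : ∀ {s t} x y → Rel s x t y → T (step (t <ᵇ s) x y)
Rel⇒step (pos k) (neg l) (inj₁ p) = ℕₚ.<⇒<ᵇ (2*-cancel k l (ℕₚ.<-trans (ℕₚ.n<1+n _) p))
Rel⇒step (pos k) (neg l) (inj₂ (inj₁ (() , _)))
Rel⇒step (pos k) (neg l) (inj₂ (inj₂ (() , _)))
Rel⇒step (pos k) (pos l) (inj₁ p) = from (T-∨ {k <ᵇ l}) (inj₁ (ℕₚ.<⇒<ᵇ (2*-cancel k l (ℕₚ.≤-pred p))))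
Rel⇒step (pos k) (pos _) (inj₂ (inj₁ (≡.refl , _ , s<t))) =
  from (T-∨ {k <ᵇ k}) (inj₂ (from T-∧ (≮⇒T-not s<t , ℕₚ.≡⇒≡ᵇ k k ≡.refl)))
Rel⇒step (neg k) (neg l) (inj₁ p) = from (T-∨ {k <ᵇ l}) (inj₁ (ℕₚ.<⇒<ᵇ (2*-cancel k l p)))
Rel⇒step (neg k) (neg _) (inj₂ (inj₂ (≡.refl , _ , t<s))) =
  from (T-∨ {k <ᵇ k}) (inj₂ (from T-∧ (ℕₚ.<⇒<ᵇ t<s , ℕₚ.≡⇒≡ᵇ k k ≡.refl)))
Rel⇒step (neg k) (pos l) (inj₂ (inj₁ (() , _)))
Rel⇒step (neg k) (pos l) (inj₂ (inj₂ (() , _)))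
Rel⇒step (neg k) (pos l) (inj₁ p) with ℕₚ.m≤n⇒m<n∨m≡n (2*-suc-cancel k l p)
... | inj₁ k<l = from (T-∨ {k <ᵇ l}) (inj₁ (ℕₚ.<⇒<ᵇ k<l))
... | inj₂ k≡l = from (T-∨ {k <ᵇ l}) (inj₂ (ℕₚ.≡⇒≡ᵇ k l k≡l))

-- The predicate `g` stands for the constraint coming from the preceding entry, so the recursion
-- runs from left to right and the first entry is no special case.
chain : {n : ℕ} → (ℙ± → Bool) → (ℕ → Bool) → Vec ℙ± n → Bool
chain g D []      = true
chain g D (x ∷ v) = g x ∧ chain (step (D 0) x) (D ∘ suc) v

anyValue : ℙ± → Bool
anyValue _ = true

Ordered : {n : ℕ} → (ℕ → ℕ) → Vec ℙ± n → Set
Ordered {n} σ v = ∀ (i j : Fin n) → toℕ i ℕ.< toℕ j →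
  Rel (σ (toℕ i)) (lookup v i) (σ (toℕ j)) (lookup v j)

InjectiveBelow : ℕ → (ℕ → ℕ) → Set
InjectiveBelow n σ = ∀ {i j} → i ℕ.< n → j ℕ.< n → σ i ≡ σ j → i ≡ j

descent : (ℕ → ℕ) → ℕ → Bool
descent σ i = σ (suc i) <ᵇ σ i

InjectiveBelow-suc : ∀ {n σ} → InjectiveBelow (suc n) σ → InjectiveBelow n (σ ∘ suc)
InjectiveBelow-suc inj i<n j<n eq = ℕₚ.suc-injective (inj (s<s i<n) (s<s j<n) eq)

chain⇒Ordered : ∀ {n} σ (v : Vec ℙ± n) → InjectiveBelow n σ →
                T (chain anyValue (descent σ) v) → Ordered σ v
chain⇒Ordered σ (x ∷ y ∷ v) inj c = go
  where
  cs = to (T-∧ {step (descent σ 0) x y}) c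
  tail = chain⇒Ordered (σ ∘ suc) (y ∷ v) (InjectiveBelow-suc inj) (proj₂ cs)
  head : Rel (σ 0) x (σ 1) y
  head = step⇒Rel x y (λ eq → contradiction (inj z<s (s<s z<s) eq) λ ()) (proj₁ cs)
  go : Ordered σ (x ∷ y ∷ v)
  go Fin.zero    (Fin.suc Fin.zero)    _ = head
  go Fin.zero    (Fin.suc (Fin.suc j)) _ = Rel-trans head (tail Fin.zero (Fin.suc j) z<s)
  go (Fin.suc i) (Fin.suc j) i<j = tail i j (ℕₚ.≤-pred i<j)
chain⇒Ordered σ (x ∷ []) inj c Fin.zero Fin.zero ()

Ordered⇒chain : ∀ {n} σ (v : Vec ℙ± n) → Ordered σ v → T (chain anyValue (descent σ) v)
Ordered⇒chain σ []          o = tt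
Ordered⇒chain σ (x ∷ [])    o = tt
Ordered⇒chain σ (x ∷ y ∷ v) o = from T-∧
  ( Rel⇒step x y (o Fin.zero (Fin.suc Fin.zero) z<s)
  , Ordered⇒chain (σ ∘ suc) (y ∷ v) (λ i j i<j → o (Fin.suc i) (Fin.suc j) (s<s i<j)))

-- One-line notation, and values read along the word

module _ {n : ℕ} (π : Permutation′ n) where

  word : ℕ → ℕ
  word i = oneLine π (suc i)

  word-toℕ : ∀ i → word (toℕ i) ≡ suc (toℕ (π ⟨$⟩ʳ i))
  word-toℕ i with toℕ i ℕ.<? n
  ... | yes p = cong (λ j → suc (toℕ (π ⟨$⟩ʳ j))) (fromℕ<-toℕ i p)
  ... | no ¬p = contradiction (toℕ<n i) ¬p

  word-injective : InjectiveBelow n word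
  word-injective {i} {j} i<n j<n eq =
    subst₂ _≡_ (toℕ-fromℕ< i<n) (toℕ-fromℕ< j<n) (cong toℕ (
      ≡.trans (≡.sym (Perm.inverseˡ π)) (≡.trans (cong (π ⟨$⟩ˡ_) π-eq) (Perm.inverseˡ π))))
    where
    at : ∀ {k} (k<n : k ℕ.< n) → word k ≡ suc (toℕ (π ⟨$⟩ʳ fromℕ< k<n))
    at k<n = ≡.trans (cong word (≡.sym (toℕ-fromℕ< k<n))) (word-toℕ (fromℕ< k<n))
    π-eq : π ⟨$⟩ʳ fromℕ< i<n ≡ π ⟨$⟩ʳ fromℕ< j<n
    π-eq = toℕ-injective (ℕₚ.suc-injective (≡.trans (≡.sym (at i<n)) (≡.trans eq (at j<n))))

  -- `Peak` tests an ascent on the left, while the weights test the failure of a descent. Distinct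
  -- letters reconcile the two, and the bound keeps both positions inside the word, where letters
  -- are distinct.
  word-flip : ∀ i → suc i ℕ.< n → (word i <ᵇ word (suc i)) ≡ not (descent word i)
  word-flip i i+1<n with ℕₚ.<-cmp (word i) (word (suc i))
  ... | tri≈ _ eq _ =
    contradiction (word-injective (ℕₚ.<-trans (ℕₚ.n<1+n i) i+1<n) i+1<n eq) (ℕₚ.<⇒≢ (ℕₚ.n<1+n i))
  ... | tri< lt _ ≯
    with word i <ᵇ word (suc i) | ℕₚ.<⇒<ᵇ lt | word (suc i) <ᵇ word i | ℕₚ.<ᵇ⇒< (word (suc i)) (word i)
  ...   | true | _ | true  | f = contradiction (f tt) ≯
  ...   | true | _ | false | f = ≡.refl
  word-flip i i+1<n | tri> ≮ _ gt
    with word (suc i) <ᵇ word i | ℕₚ.<⇒<ᵇ gt | word i <ᵇ word (suc i) | ℕₚ.<ᵇ⇒< (word i) (word (suc i))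
  ...   | true | _ | true  | f = contradiction (f tt) ≮
  ...   | true | _ | false | f = ≡.refl

  -- If `v` lists the values of f along the word of π, this lists them by label.
  reindex : {A : Set} → Vec A n → Vec A n
  reindex v = tabulate (λ a → lookup v (π ⟨$⟩ˡ a))

  module _ (v : Vec ℙ± n) where

    private
      f = lookup (reindex v)

      f-π : ∀ i → f (π ⟨$⟩ʳ i) ≡ lookup v i
      f-π i = ≡.trans (Vecₚ.lookup∘tabulate _ (π ⟨$⟩ʳ i)) (cong (lookup v) (Perm.inverseˡ π))

      word-π⁻¹ : ∀ a → word (toℕ (π ⟨$⟩ˡ a)) ≡ suc (toℕ a)
      word-π⁻¹ a = ≡.trans (word-toℕ _) (cong (suc ∘ toℕ) (Perm.inverseʳ π))

    EnrichedPP⇒Ordered : EnrichedPP (λ a b → a <[ π ] b) f → Ordered word v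
    EnrichedPP⇒Ordered en i j i<j
      with en (π ⟨$⟩ʳ i) (π ⟨$⟩ʳ j)
             (subst₂ (λ a b → toℕ a ℕ.< toℕ b) (≡.sym (Perm.inverseˡ π)) (≡.sym (Perm.inverseˡ π)) i<j)
    ... | up , down rewrite f-π i | f-π j | word-toℕ i | word-toℕ j
      with ℕₚ.<-cmp (toℕ (π ⟨$⟩ʳ i)) (toℕ (π ⟨$⟩ʳ j))
    ... | tri< lt _ _ = [ inj₁ , (λ (e , p) → inj₂ (inj₁ (e , p , s<s lt))) ]′ (up lt)
    ... | tri> _ _ gt = [ inj₁ , (λ (e , p) → inj₂ (inj₂ (e , p , s<s gt))) ]′ (down gt)
    ... | tri≈ _ eq _ = contradiction (≡.trans (≡.sym (Perm.inverseˡ π))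
            (≡.trans (cong (π ⟨$⟩ˡ_) (toℕ-injective eq)) (Perm.inverseˡ π)))
            (λ i≡j → ℕₚ.<⇒≢ i<j (cong toℕ i≡j))

    Ordered⇒EnrichedPP : Ordered word v → EnrichedPP (λ a b → a <[ π ] b) f
    Ordered⇒EnrichedPP o a b a<b with o (π ⟨$⟩ˡ a) (π ⟨$⟩ˡ b) a<b
    ... | r rewrite Vecₚ.lookup∘tabulate (λ a → lookup v (π ⟨$⟩ˡ a)) a
                  | Vecₚ.lookup∘tabulate (λ a → lookup v (π ⟨$⟩ˡ a)) b
                  | word-π⁻¹ a | word-π⁻¹ b = up r , down r
      where
      up : ∀ {x y} → Rel (suc (toℕ a)) x (suc (toℕ b)) y → toℕ a ℕ.< toℕ b → (x <± y) ⊎ (x ≡ y × IsPos x)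
      up (inj₁ p) _ = inj₁ p
      up (inj₂ (inj₁ (e , p , _))) _ = inj₂ (e , p)
      up (inj₂ (inj₂ (e , p , gt))) lt = contradiction lt (ℕₚ.<⇒≯ (ℕₚ.≤-pred gt))
      down : ∀ {x y} → Rel (suc (toℕ a)) x (suc (toℕ b)) y → toℕ b ℕ.< toℕ a → (x <± y) ⊎ (x ≡ y × IsNeg x)
      down (inj₁ p) _ = inj₁ p
      down (inj₂ (inj₂ (e , p , _))) _ = inj₂ (e , p)
      down (inj₂ (inj₁ (e , p , lt))) gt = contradiction gt (ℕₚ.<⇒≯ (ℕₚ.≤-pred lt))

    enriched?≡chain : does (enriched? (λ a b → a <[ π ] b)
                        (λ a b → toℕ (π ⟨$⟩ˡ a) ℕ.<? toℕ (π ⟨$⟩ˡ b)) f) ≡ chain anyValue (descent word) v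
    enriched?≡chain = does-⇔ (mk⇔
        (Ordered⇒chain word v ∘ EnrichedPP⇒Ordered)
        (Ordered⇒EnrichedPP ∘ chain⇒Ordered word v word-injective))
      (enriched? _ (λ a b → toℕ (π ⟨$⟩ˡ a) ℕ.<? toℕ (π ⟨$⟩ˡ b)) f)
      (T? (chain anyValue (descent word) v))

lookup-injective : ∀ {A : Set} {n} {v w : Vec A n} → (∀ i → lookup v i ≡ lookup w i) → v ≡ w
lookup-injective {v = v} {w} eq =
  ≡.trans (≡.sym (Vecₚ.tabulate∘lookup v)) (≡.trans (Vecₚ.tabulate-cong eq) (Vecₚ.tabulate∘lookup w))

-- Finite sums in a commutative ring

module FiniteSums {c ℓ : Level} (R : CommutativeRing c ℓ) where
  open CommutativeRing R
  open import Relation.Binary.Reasoning.Setoid setoid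
  open import Algebra.Solver.Ring.NaturalCoefficients.Default commutativeSemiring
    using (solve; con; _:+_; _:*_; _:=_)

  ind : Bool → Carrier
  ind true  = 1#
  ind false = 0#

  ind-∧ : ∀ a b → ind (a ∧ b) ≈ ind a * ind b
  ind-∧ true  b = sym (*-identityˡ _)
  ind-∧ false b = sym (zeroˡ _)

  if≈ind : ∀ b {x} → (if b then x else 0#) ≈ ind b * x
  if≈ind true  = sym (*-identityˡ _)
  if≈ind false = sym (zeroˡ _)

  +-interchange : ∀ a b c d → (a + b) + (c + d) ≈ (a + c) + (b + d)
  +-interchange = solve 4 (λ a b c d → (a :+ b) :+ (c :+ d) := (a :+ c) :+ (b :+ d)) refl

  *-swap : ∀ a b c → a * (b * c) ≈ b * (a * c)
  *-swap = solve 3 (λ a b c → a :* (b :* c) := b :* (a :* c)) refl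

  module _ {a : Level} {A : Set a} where

    ∑ : List A → (A → Carrier) → Carrier
    ∑ xs f = sumR R (map f xs)

    ∏ : List A → (A → Carrier) → Carrier
    ∏ xs f = List.foldr _*_ 1# (map f xs)

    ∑-cong-All : ∀ {P : A → Set} {xs} {f g : A → Carrier} →
                 Allₗ.All P xs → (∀ {x} → P x → f x ≈ g x) → ∑ xs f ≈ ∑ xs g
    ∑-cong-All []         f≈g = refl
    ∑-cong-All (px ∷ pxs) f≈g = +-cong (f≈g px) (∑-cong-All pxs f≈g)

    ∑-cong : ∀ xs {f g : A → Carrier} → (∀ x → f x ≈ g x) → ∑ xs f ≈ ∑ xs g
    ∑-cong []       f≈g = refl
    ∑-cong (x ∷ xs) f≈g = +-cong (f≈g x) (∑-cong xs f≈g)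

    ∏-cong-All : ∀ {P : A → Set} {xs} {f g : A → Carrier} →
                 Allₗ.All P xs → (∀ {x} → P x → f x ≈ g x) → ∏ xs f ≈ ∏ xs g
    ∏-cong-All []         f≈g = refl
    ∏-cong-All (px ∷ pxs) f≈g = *-cong (f≈g px) (∏-cong-All pxs f≈g)

    ∑-++ : ∀ xs ys {f : A → Carrier} → ∑ (xs List.++ ys) f ≈ ∑ xs f + ∑ ys f
    ∑-++ []       ys = sym (+-identityˡ _)
    ∑-++ (x ∷ xs) ys = trans (+-congˡ (∑-++ xs ys)) (sym (+-assoc _ _ _))

    ∑-+ : ∀ xs {f g : A → Carrier} → ∑ xs (λ x → f x + g x) ≈ ∑ xs f + ∑ xs g
    ∑-+ []       = sym (+-identityˡ _)
    ∑-+ (x ∷ xs) = trans (+-congˡ (∑-+ xs)) (+-interchange _ _ _ _)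

    ∑-0 : ∀ xs → ∑ xs (λ _ → 0#) ≈ 0#
    ∑-0 []       = refl
    ∑-0 (x ∷ xs) = trans (+-identityˡ _) (∑-0 xs)

    *-∑ : ∀ r xs {f : A → Carrier} → r * ∑ xs f ≈ ∑ xs (λ x → r * f x)
    *-∑ r []       = zeroʳ r
    *-∑ r (x ∷ xs) = trans (distribˡ r _ _) (+-congˡ (*-∑ r xs))

    ∑-* : ∀ xs r {f : A → Carrier} → ∑ xs f * r ≈ ∑ xs (λ x → f x * r)
    ∑-* []       r = zeroˡ r
    ∑-* (x ∷ xs) r = trans (distribʳ r _ _) (+-congˡ (∑-* xs r))

    ∑-filterᵇ : ∀ p xs {f : A → Carrier} → ∑ (filterᵇ p xs) f ≈ ∑ xs (λ x → ind (p x) * f x)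
    ∑-filterᵇ p []       = refl
    ∑-filterᵇ p (x ∷ xs) with p x
    ... | true  = +-cong (sym (*-identityˡ _)) (∑-filterᵇ p xs)
    ... | false = trans (∑-filterᵇ p xs) (sym (trans (+-congʳ (zeroˡ _)) (+-identityˡ _)))

  module _ {a b : Level} {A : Set a} {B : Set b} where

    ∑-map : ∀ (g : A → B) xs {f : B → Carrier} → ∑ (map g xs) f ≈ ∑ xs (f ∘ g)
    ∑-map g []       = refl
    ∑-map g (x ∷ xs) = +-congˡ (∑-map g xs)

    ∏-map : ∀ (g : A → B) xs {f : B → Carrier} → ∏ (map g xs) f ≈ ∏ xs (f ∘ g)
    ∏-map g []       = refl
    ∏-map g (x ∷ xs) = *-congˡ (∏-map g xs)

    ∑-concatMap : ∀ (g : A → List B) xs {f : B → Carrier} →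
                  ∑ (concatMap g xs) f ≈ ∑ xs (λ x → ∑ (g x) f)
    ∑-concatMap g []       = refl
    ∑-concatMap g (x ∷ xs) = trans (∑-++ (g x) _) (+-congˡ (∑-concatMap g xs))

    ∑-swap : ∀ xs ys {f : A → B → Carrier} →
             ∑ xs (λ x → ∑ ys (f x)) ≈ ∑ ys (λ y → ∑ xs (λ x → f x y))
    ∑-swap []       ys = sym (∑-0 ys)
    ∑-swap (x ∷ xs) ys = trans (+-congˡ (∑-swap xs ys)) (sym (∑-+ ys))

  ∑-upTo-suc : ∀ N (f : ℕ → Carrier) → ∑ (upTo (suc N)) f ≈ f 0 + ∑ (upTo N) (f ∘ suc)
  ∑-upTo-suc N f = +-congˡ (reflexive (cong (sumR R)
    (≡.trans (map-applyUpTo suc f N) (≡.sym (map-upTo (f ∘ suc) N)))))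

  ∏-upTo-suc : ∀ N (f : ℕ → Carrier) → ∏ (upTo (suc N)) f ≈ f 0 * ∏ (upTo N) (f ∘ suc)
  ∏-upTo-suc N f = *-congˡ (reflexive (cong (List.foldr _*_ 1#)
    (≡.trans (map-applyUpTo suc f N) (≡.sym (map-upTo (f ∘ suc) N)))))

  ∑-upTo-δ : ∀ N {k} (f : ℕ → Carrier) → k ℕ.< N → ∑ (upTo N) (λ l → ind (k ≡ᵇ l) * f l) ≈ f k
  ∑-upTo-δ (suc N) {zero} f _ = begin
    ∑ (upTo (suc N)) (λ l → ind (0 ≡ᵇ l) * f l) ≈⟨ ∑-upTo-suc N _ ⟩
    1# * f 0 + ∑ (upTo N) (λ l → 0# * f (suc l)) ≈⟨ +-cong (*-identityˡ _) (∑-cong (upTo N) λ l → zeroˡ _) ⟩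
    f 0 + ∑ (upTo N) (λ _ → 0#)                  ≈⟨ +-congˡ (∑-0 (upTo N)) ⟩
    f 0 + 0#                                     ≈⟨ +-identityʳ _ ⟩
    f 0                                          ∎
  ∑-upTo-δ (suc N) {suc k} f (s<s k<N) = begin
    ∑ (upTo (suc N)) (λ l → ind (suc k ≡ᵇ l) * f l)               ≈⟨ ∑-upTo-suc N _ ⟩
    0# * f 0 + ∑ (upTo N) (λ l → ind (k ≡ᵇ l) * f (suc l))        ≈⟨ +-cong (zeroˡ _) (∑-upTo-δ N (f ∘ suc) k<N) ⟩
    0# + f (suc k)                                                ≈⟨ +-identityˡ _ ⟩
    f (suc k)                                                     ∎

  -- Sums over vectors and over subsets

  module _ {A : Set} where

    ∑-allVecs : ∀ (xs : List A) n {F : Vec A (suc n) → Carrier} →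
                ∑ (allVecs xs (suc n)) F ≈ ∑ xs (λ x → ∑ (allVecs xs n) (λ v → F (x ∷ v)))
    ∑-allVecs xs n = trans (∑-concatMap _ xs) (∑-cong xs λ x → ∑-map (x ∷_) (allVecs xs n))

    -- Iterated sums commute, so any coordinate can be summed out in place of the first; `∑-reindex`
    -- takes the coordinate of the first letter of the word.
    ∑-allVecs-insertAt : ∀ (xs : List A) n (i : Fin (suc n)) {F : Vec A (suc n) → Carrier} →
      ∑ (allVecs xs (suc n)) F ≈ ∑ xs (λ x → ∑ (allVecs xs n) (λ v → F (insertAt v i x)))
    ∑-allVecs-insertAt xs n       Fin.zero    = ∑-allVecs xs n
    ∑-allVecs-insertAt xs (suc n) (Fin.suc i) {F} = begin
      ∑ (allVecs xs (suc (suc n))) F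
        ≈⟨ ∑-allVecs xs (suc n) ⟩
      ∑ xs (λ y → ∑ (allVecs xs (suc n)) (λ v → F (y ∷ v)))
        ≈⟨ ∑-cong xs (λ y → ∑-allVecs-insertAt xs n i) ⟩
      ∑ xs (λ y → ∑ xs (λ x → ∑ (allVecs xs n) (λ v → F (y ∷ insertAt v i x))))
        ≈⟨ ∑-swap xs xs ⟩
      ∑ xs (λ x → ∑ xs (λ y → ∑ (allVecs xs n) (λ v → F (y ∷ insertAt v i x))))
        ≈⟨ ∑-cong xs (λ x → ∑-allVecs xs n) ⟨
      ∑ xs (λ x → ∑ (allVecs xs (suc n)) (λ v → F (insertAt v (Fin.suc i) x))) ∎

    reindex-∷ : ∀ {n} (π : Permutation′ (suc n)) x (v : Vec A n) →
      reindex π (x ∷ v) ≡ insertAt (reindex (Perm.remove Fin.zero π) v) (π ⟨$⟩ʳ Fin.zero) x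
    reindex-∷ {n} π x v = lookup-injective λ a →
      ≡.trans (Vecₚ.lookup∘tabulate (λ a → lookup (x ∷ v) (π ⟨$⟩ˡ a)) a) (≡.sym (at a))
      where
      i = π ⟨$⟩ʳ Fin.zero
      ρ = Perm.remove Fin.zero π
      w = insertAt (reindex ρ v) i x
      at : ∀ a → lookup w a ≡ lookup (x ∷ v) (π ⟨$⟩ˡ a)
      at a with i Fin.≟ a
      ... | yes ≡.refl = ≡.trans (Vecₚ.insertAt-lookup (reindex ρ v) i x)
                           (≡.sym (cong (lookup (x ∷ v)) (Perm.inverseˡ π)))
      ... | no i≢a = ≡.trans (cong (lookup w) (≡.sym (punchIn-punchOut i≢a)))
          (≡.trans (Vecₚ.insertAt-punchIn (reindex ρ v) i x b)
          (≡.trans (Vecₚ.lookup∘tabulate _ b)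
          (cong (lookup (x ∷ v)) (≡.trans (≡.sym π⁻¹-b) (cong (π ⟨$⟩ˡ_) (punchIn-punchOut i≢a))))))
        where
        b = punchOut i≢a
        -- `punchIn-permute` describes π on the remaining positions, so `b` is first written as the
        -- image under ρ of its preimage.
        π⁻¹-b : π ⟨$⟩ˡ (punchIn i b) ≡ Fin.suc (ρ ⟨$⟩ˡ b)
        π⁻¹-b = ≡.trans (cong (λ c → π ⟨$⟩ˡ (punchIn i c)) (≡.sym (Perm.inverseʳ ρ)))
          (≡.trans (cong (π ⟨$⟩ˡ_) (≡.sym (Perm.punchIn-permute π Fin.zero (ρ ⟨$⟩ˡ b))))
            (Perm.inverseˡ π))

    -- Relabelling permutes the list of vectors, but the rearrangement is never exhibited: removing
    -- the first position and its label leaves a smaller permutation, to which induction applies.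
    ∑-reindex : ∀ (xs : List A) n (π : Permutation′ n) {F : Vec A n → Carrier} →
      ∑ (allVecs xs n) F ≈ ∑ (allVecs xs n) (F ∘ reindex π)
    ∑-reindex xs zero    π {F} = refl
    ∑-reindex xs (suc n) π {F} = begin
      ∑ (allVecs xs (suc n)) F
        ≈⟨ ∑-allVecs-insertAt xs n (π ⟨$⟩ʳ Fin.zero) ⟩
      ∑ xs (λ x → ∑ (allVecs xs n) (λ v → F (insertAt v (π ⟨$⟩ʳ Fin.zero) x)))
        ≈⟨ ∑-cong xs (λ x → ∑-reindex xs n (Perm.remove Fin.zero π)) ⟩
      ∑ xs (λ x → ∑ (allVecs xs n) (λ v → F (insertAt (reindex (Perm.remove Fin.zero π) v) (π ⟨$⟩ʳ Fin.zero) x)))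
        ≈⟨ ∑-cong xs (λ x → ∑-cong (allVecs xs n) λ v → reflexive (cong F (reindex-∷ π x v))) ⟨
      ∑ xs (λ x → ∑ (allVecs xs n) (λ v → F (reindex π (x ∷ v))))
        ≈⟨ ∑-allVecs xs n ⟨
      ∑ (allVecs xs (suc n)) (F ∘ reindex π) ∎

    ∑-sublists-filterᵇ : ∀ p x (xs : List A) {F : List A → Carrier} →
      ∑ (sublists (filterᵇ p (x ∷ xs))) F ≈
      ∑ (sublists (filterᵇ p xs)) F + ind (p x) * ∑ (sublists (filterᵇ p xs)) (F ∘ (x ∷_))
    ∑-sublists-filterᵇ p x xs with p x
    ... | false = sym (trans (+-congˡ (zeroˡ _)) (+-identityʳ _))
    ... | true  = trans (∑-++ (sublists (filterᵇ p xs)) _)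
                    (+-congˡ (trans (∑-map (x ∷_) (sublists (filterᵇ p xs))) (sym (*-identityˡ _))))

    sublists⁺ : ∀ {P : A → Set} {xs} → Allₗ.All P xs → Allₗ.All (Allₗ.All P) (sublists xs)
    sublists⁺ []         = [] ∷ []
    sublists⁺ (px ∷ pxs) = ++⁺ (sublists⁺ pxs) (map⁺ (Allₗ.map (px ∷_) (sublists⁺ pxs)))

  ≢⇒≡ᵇ-false : ∀ {x y} → x ≢ y → (x ≡ᵇ y) ≡ false
  ≢⇒≡ᵇ-false {x} {y} x≢y with x ≡ᵇ y | ℕₚ.≡ᵇ⇒≡ x y
  ... | true  | f = contradiction (f tt) x≢y
  ... | false | _ = ≡.refl

  ≡ᵇ-refl : ∀ x → (x ≡ᵇ x) ≡ true
  ≡ᵇ-refl zero    = ≡.refl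
  ≡ᵇ-refl (suc x) = ≡ᵇ-refl x

  ∉⇒∈ᵇ-false : ∀ {x ys} → Allₗ.All (x ≢_) ys → (x ∈ᵇ ys) ≡ false
  ∉⇒∈ᵇ-false []           = ≡.refl
  ∉⇒∈ᵇ-false (x≢y ∷ x≢ys) rewrite ≢⇒≡ᵇ-false x≢y = ∉⇒∈ᵇ-false x≢ys

  disjointᵇ-∷ˡ : ∀ {x J} I → Allₗ.All (x ≢_) J → disjointᵇ (x ∷ I) J ≡ disjointᵇ I J
  disjointᵇ-∷ˡ I x∉J rewrite ∉⇒∈ᵇ-false x∉J = ≡.refl

  disjointᵇ-∷ʳ : ∀ {x I} J → Allₗ.All (x ≢_) I → disjointᵇ I (x ∷ J) ≡ disjointᵇ I J
  disjointᵇ-∷ʳ J []           = ≡.refl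
  disjointᵇ-∷ʳ J (x≢y ∷ x∉I) rewrite ≢⇒≡ᵇ-false (x≢y ∘ ≡.sym) =
    cong₂ (λ a b → not (a ∨ b)) ≡.refl (not-injective (disjointᵇ-∷ʳ J x∉I))

  disjointᵇ-∷∷ : ∀ x I J → disjointᵇ (x ∷ I) (x ∷ J) ≡ false
  disjointᵇ-∷∷ x I J rewrite ≡ᵇ-refl x = ≡.refl

  module _ (a b : ℕ → Carrier) where

    private
      weight : List ℕ → List ℕ → Carrier
      weight I J = ind (disjointᵇ I J) * (∏ J b * ∏ I a)

      disjointSum : (D P : ℕ → Bool) → List ℕ → Carrier
      disjointSum D P xs = ∑ (sublists (filterᵇ D xs)) λ I → ∑ (sublists (filterᵇ P xs)) λ J → weight I J

    -- Each x ∈ xs lies in exactly one of I, J or neither.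
    ∑-disjoint-sublists : ∀ (D P : ℕ → Bool) {xs} → Unique xs →
      disjointSum D P xs ≈ ∏ xs (λ x → 1# + ind (D x) * a x + ind (P x) * b x)
    ∑-disjoint-sublists D P [] = trans (+-identityʳ _) (trans (+-identityʳ _)
      (trans (*-identityˡ _) (*-identityˡ _)))
    ∑-disjoint-sublists D P {x ∷ xs} (x∉xs ∷ uniq) = begin
      disjointSum D P (x ∷ xs)
        ≈⟨ ∑-sublists-filterᵇ D x xs ⟩
      ∑ Is (λ I → ∑ (sublists (filterᵇ P (x ∷ xs))) (weight I)) +
        ind (D x) * ∑ Is (λ I → ∑ (sublists (filterᵇ P (x ∷ xs))) (weight (x ∷ I)))
        ≈⟨ +-cong (∑-cong-All x∉Is without) (*-congˡ (∑-cong Is with-x)) ⟩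
      ∑ Is (λ I → S I + ind (P x) * b x * S I) + ind (D x) * ∑ Is (λ I → a x * S I)
        ≈⟨ +-cong (trans (∑-+ Is) (+-congˡ (sym (*-∑ _ Is)))) (*-congˡ (sym (*-∑ _ Is))) ⟩
      (W + ind (P x) * b x * W) + ind (D x) * (a x * W)
        ≈⟨ factor W (ind (D x)) (a x) (ind (P x)) (b x) ⟩
      (1# + ind (D x) * a x + ind (P x) * b x) * W
        ≈⟨ *-congˡ (∑-disjoint-sublists D P uniq) ⟩
      ∏ (x ∷ xs) (λ x → 1# + ind (D x) * a x + ind (P x) * b x) ∎
      where
      Is = sublists (filterᵇ D xs)
      Js = sublists (filterᵇ P xs)
      S : List ℕ → Carrier
      S I = ∑ Js (weight I)
      W = disjointSum D P xs
      -- Uniqueness makes `x` new to every sublist of the rest. Adding it to only one of I and J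
      -- thus leaves the disjointness test as it was, and adding it to both makes the test fail.
      x∉Is : Allₗ.All (Allₗ.All (x ≢_)) Is
      x∉Is = sublists⁺ (filter⁺ (T? ∘ D) x∉xs)
      x∉Js : Allₗ.All (Allₗ.All (x ≢_)) Js
      x∉Js = sublists⁺ (filter⁺ (T? ∘ P) x∉xs)
      without : ∀ {I} → Allₗ.All (x ≢_) I →
        ∑ (sublists (filterᵇ P (x ∷ xs))) (weight I) ≈ S I + ind (P x) * b x * S I
      without {I} x∉I = trans (∑-sublists-filterᵇ P x xs) (+-congˡ (trans (*-congˡ
        (trans (∑-cong Js λ J → trans (*-cong (reflexive (cong ind (disjointᵇ-∷ʳ J x∉I)))
          (*-assoc _ _ _)) (*-swap _ _ _)) (sym (*-∑ (b x) Js)))) (sym (*-assoc _ _ _))))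
      with-x : ∀ I → ∑ (sublists (filterᵇ P (x ∷ xs))) (weight (x ∷ I)) ≈ a x * S I
      with-x I = begin
        ∑ (sublists (filterᵇ P (x ∷ xs))) (weight (x ∷ I))
          ≈⟨ ∑-sublists-filterᵇ P x xs ⟩
        ∑ Js (weight (x ∷ I)) + ind (P x) * ∑ Js (λ J → weight (x ∷ I) (x ∷ J))
          ≈⟨ +-cong (∑-cong-All x∉Js λ {J} x∉J → trans (*-congʳ (reflexive (cong ind (disjointᵇ-∷ˡ I x∉J))))
               (pull-out _ _ _ _))
             (*-congˡ (trans (∑-cong Js λ J → trans (*-congʳ (reflexive (cong ind (disjointᵇ-∷∷ x I J))))
               (zeroˡ _)) (∑-0 Js))) ⟩
        ∑ Js (λ J → a x * weight I J) + ind (P x) * 0#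
          ≈⟨ trans (+-cong (sym (*-∑ (a x) Js)) (zeroʳ _)) (+-identityʳ _) ⟩
        a x * S I ∎
        where
        pull-out : ∀ i p y r → i * (p * (y * r)) ≈ y * (i * (p * r))
        pull-out = solve 4 (λ i p y r → i :* (p :* (y :* r)) := y :* (i :* (p :* r))) refl
      factor : ∀ t d y p z → (t + p * z * t) + d * (y * t) ≈ (1# + d * y + p * z) * t
      factor = solve 5 (λ t d y p z → (t :+ p :* z :* t) :+ d :* (y :* t)
        := (con 1 :+ d :* y :+ p :* z) :* t) refl

-- Exponent vectors and merged compositions

negatives : ∀ {n} → Vec ℙ± n → ℕ
negatives v = Vec.sum (tabulate λ i → if isNegᵇ (lookup v i) then 1 else 0)

module Exponents (N : ℕ) where

  _⊕_ : Vec ℕ N → Vec ℕ N → Vec ℕ N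
  _⊕_ = zipWith ℕ._+_

  bump : ℕ → ℕ → Vec ℕ N
  bump k a = tabulate λ j → if k ≡ᵇ toℕ j then a else 0

  -- The exponent vector of ∏ᵢ x_{hᵢ}^{αᵢ}.
  exponent : ∀ {n} → Vec ℕ n → Vec ℕ n → Vec ℕ N
  exponent []      []      = replicate N 0
  exponent (a ∷ α) (k ∷ h) = bump k a ⊕ exponent α h

  -- This is the law that the powers of one variable with exponents a and b multiply to the power
  -- with exponent a + b, the only fact about monomials that the merging of parts requires.
  bump-+ : ∀ k a b m → bump k (a ℕ.+ b) ⊕ m ≡ bump k a ⊕ (bump k b ⊕ m)
  bump-+ k a b m = lookup-injective λ j → begin
    lookup (bump k (a ℕ.+ b) ⊕ m) j
      ≡⟨ at j (a ℕ.+ b) m ⟩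
    (if k ≡ᵇ toℕ j then a ℕ.+ b else 0) ℕ.+ lookup m j
      ≡⟨ split (k ≡ᵇ toℕ j) (lookup m j) ⟩
    (if k ≡ᵇ toℕ j then a else 0) ℕ.+ ((if k ≡ᵇ toℕ j then b else 0) ℕ.+ lookup m j)
      ≡⟨ cong ((if k ≡ᵇ toℕ j then a else 0) ℕ.+_) (at j b m) ⟨
    (if k ≡ᵇ toℕ j then a else 0) ℕ.+ lookup (bump k b ⊕ m) j
      ≡⟨ at j a (bump k b ⊕ m) ⟨
    lookup (bump k a ⊕ (bump k b ⊕ m)) j ∎
    where
    open ≡.≡-Reasoning
    at : ∀ j a m → lookup (bump k a ⊕ m) j ≡ (if k ≡ᵇ toℕ j then a else 0) ℕ.+ lookup m j
    at j a m = ≡.trans (Vecₚ.lookup-zipWith ℕ._+_ j (bump k a) m)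
      (cong (ℕ._+ lookup m j) (Vecₚ.lookup∘tabulate _ j))
    split : ∀ c x → (if c then a ℕ.+ b else 0) ℕ.+ x ≡ (if c then a else 0) ℕ.+ ((if c then b else 0) ℕ.+ x)
    split true  x = ℕₚ.+-assoc a b x
    split false x = ≡.refl

  exponent-tabulate : ∀ {n} (α h : Vec ℕ n) →
    tabulate (λ j → Vec.sum (tabulate λ i → if lookup h i ≡ᵇ toℕ j then lookup α i else 0)) ≡ exponent α h
  exponent-tabulate []      []      = lookup-injective λ j →
    ≡.trans (Vecₚ.lookup∘tabulate _ j) (≡.sym (Vecₚ.lookup-replicate j 0))
  exponent-tabulate (a ∷ α) (k ∷ h) = lookup-injective λ j →
    ≡.trans (Vecₚ.lookup∘tabulate _ j) (≡.sym (≡.trans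
      (Vecₚ.lookup-zipWith ℕ._+_ j (bump k a) (exponent α h))
      (cong₂ ℕ._+_ (Vecₚ.lookup∘tabulate _ j)
        (≡.trans (cong (λ m → lookup m j) (≡.sym (exponent-tabulate α h))) (Vecₚ.lookup∘tabulate _ j)))))

sum-permute : ∀ {n} (π : Permutation′ n) (g : Fin n → ℕ) →
  Vec.sum (tabulate (λ a → g (π ⟨$⟩ˡ a))) ≡ Vec.sum (tabulate g)
sum-permute π g = ≡.trans (sum-tabulate (λ a → g (π ⟨$⟩ˡ a)))
  (≡.trans (≡.sym (ℕΣ.sum-permute g (Perm.flip π))) (≡.sym (sum-tabulate g)))
  where
  sum-tabulate : ∀ {n} (f : Fin n → ℕ) → Vec.sum (tabulate f) ≡ ℕΣ.sum f
  sum-tabulate {zero}  f = ≡.refl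
  sum-tabulate {suc n} f = cong (f Fin.zero ℕ.+_) (sum-tabulate (f ∘ Fin.suc))

-- A nonempty composition is kept as its first part and the rest, so that a part can be added to the
-- first one without a case distinction.
mergeHead : Bool → ℕ → ℕ × List ℕ → ℕ × List ℕ
mergeHead true  a (c , γ) = a ℕ.+ c , γ
mergeHead false a (c , γ) = a , c ∷ γ

-- Adds up the parts of the nonempty composition a ∷ r that p links; p i
-- concerns the parts with (0-based) indices i and i + 1.
merge : ∀ {m} → (ℕ → Bool) → ℕ → Vec ℕ m → ℕ × List ℕ
merge p a []      = a , []
merge p a (b ∷ r) = mergeHead (p 0) a (merge (p ∘ suc) b r)

cons : ℕ × List ℕ → List ℕ
cons (c , γ) = c ∷ γ

filterᵇ-∷ : ∀ {A : Set} p (x : A) xs → filterᵇ p (x ∷ xs) ≡ (if p x then x ∷ filterᵇ p xs else filterᵇ p xs)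
filterᵇ-∷ p x xs with p x
... | true  = ≡.refl
... | false = ≡.refl

filterᵇ-map-suc : ∀ p xs → filterᵇ p (map suc xs) ≡ map suc (filterᵇ (p ∘ suc) xs)
filterᵇ-map-suc p []       = ≡.refl
filterᵇ-map-suc p (x ∷ xs) with p (suc x)
... | true  = cong (suc x ∷_) (filterᵇ-map-suc p xs)
... | false = filterᵇ-map-suc p xs

∷-↓-suc : ∀ a γ i → (a ∷ γ) ↓ suc (suc i) ≡ a ∷ (γ ↓ suc i)
∷-↓-suc a []      i = ≡.refl
∷-↓-suc a (b ∷ γ) i = ≡.refl

∷-↓set-suc : ∀ a α {I} → Allₗ.All (1 ≤_) I → (a ∷ α) ↓set map suc I ≡ a ∷ (α ↓set I)
∷-↓set-suc a α []                     = ≡.refl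
∷-↓set-suc a α {suc i ∷ I} (_ ∷ 1≤I) =
  ≡.trans (cong (_↓ suc (suc i)) (∷-↓set-suc a α 1≤I)) (∷-↓-suc a (α ↓set I) i)

-- `↓set` merges at the largest position first, so everything further left keeps its index and the
-- first part can be split off. The shift `p ∘ suc` passes from 1-based positions to 0-based links.
↓set≡merge : ∀ {m} p a (r : Vec ℕ m) →
  (a ∷ toList r) ↓set filterᵇ p (range1 (suc (length (toList r)))) ≡ cons (merge (p ∘ suc) a r)
↓set≡merge p a []      = ≡.refl
↓set≡merge p a (b ∷ r) = begin
  α ↓set filterᵇ p (1 ∷ map suc (applyUpTo suc l))
    ≡⟨ cong (λ L → α ↓set filterᵇ p (1 ∷ map suc L)) (≡.sym (map-upTo suc l)) ⟩
  α ↓set filterᵇ p (1 ∷ map suc L)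
    ≡⟨ ≡.trans (cong (α ↓set_) (filterᵇ-∷ p 1 (map suc L))) (head (p 1)) ⟩
  cons (mergeHead (p 1) a (merge (p ∘ suc ∘ suc) b r)) ∎
  where
  open ≡.≡-Reasoning
  α = a ∷ b ∷ toList r
  l = length (toList r)
  L = range1 (suc l)
  tail : α ↓set filterᵇ p (map suc L) ≡ a ∷ cons (merge (p ∘ suc ∘ suc) b r)
  tail = ≡.trans (cong (α ↓set_) (filterᵇ-map-suc p L))
    (≡.trans (∷-↓set-suc a (b ∷ toList r) (filter⁺ (T? ∘ p ∘ suc) (map⁺ (Allₗ.universal (λ _ → s≤s z≤n) (upTo l)))))
      (cong (a ∷_) (↓set≡merge (p ∘ suc) b r)))
  head : ∀ p₁ → α ↓set (if p₁ then 1 ∷ filterᵇ p (map suc L) else filterᵇ p (map suc L))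
                ≡ cons (mergeHead p₁ a (merge (p ∘ suc ∘ suc) b r))
  head true  = cong (_↓ 1) tail
  head false = tail

-- Heights that are constant across the merged positions

T-injective : ∀ {a b} → T a ⇔ T b → a ≡ b
T-injective {a} {b} e = does-⇔ e (T? a) (T? b)

-- True past the end of h, so that no position needs a range condition.
equalNext : ∀ {m} → ℕ → Vec ℕ m → ℕ → Bool
equalNext k []      i       = true
equalNext k (l ∷ h) zero    = k ≡ᵇ l
equalNext k (l ∷ h) (suc i) = equalNext l h i

compatible : ∀ {m} → (ℕ → Bool) → ℕ → Vec ℕ m → Bool
compatible p k []      = true
compatible p k (l ∷ h) = (not (p 0) ∨ (k ≡ᵇ l)) ∧ compatible (p ∘ suc) l h

implies⇔ : ∀ a b → T (not a ∨ b) ⇔ (T a → T b)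
implies⇔ true  b = mk⇔ (λ x _ → x) (λ f → f tt)
implies⇔ false b = mk⇔ (λ _ ()) (λ _ → tt)

compatible⇔ : ∀ {m} p k (h : Vec ℕ m) → T (compatible p k h) ⇔ (∀ i → T (p i) → T (equalNext k h i))
compatible⇔ p k []      = mk⇔ (λ _ _ _ → tt) (λ _ → tt)
compatible⇔ p k (l ∷ h) = mk⇔ ⇒ ⇐
  where
  ⇒ : T (compatible p k (l ∷ h)) → ∀ i → T (p i) → T (equalNext k (l ∷ h) i)
  ⇒ c zero    = to (implies⇔ (p 0) _) (proj₁ (to (T-∧ {not (p 0) ∨ (k ≡ᵇ l)}) c))
  ⇒ c (suc i) = to (compatible⇔ (p ∘ suc) l h) (proj₂ (to (T-∧ {not (p 0) ∨ (k ≡ᵇ l)}) c)) i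
  ⇐ : (∀ i → T (p i) → T (equalNext k (l ∷ h) i)) → T (compatible p k (l ∷ h))
  ⇐ f = from (T-∧ {not (p 0) ∨ (k ≡ᵇ l)})
    (from (implies⇔ (p 0) _) (f 0) , from (compatible⇔ (p ∘ suc) l h) (f ∘ suc))

∈⇔∈ᵇ : ∀ {i xs} → i ∈ xs ⇔ T (i ∈ᵇ xs)
∈⇔∈ᵇ {i} {xs} = mk⇔ (any⁺ (i ≡ᵇ_) ∘ Any.map (ℕₚ.≡⇒≡ᵇ i _)) (Any.map (ℕₚ.≡ᵇ⇒≡ i _) ∘ any⁻ (i ≡ᵇ_) xs)

all⇔ : ∀ (e : ℕ → Bool) xs → T (all e xs) ⇔ (∀ i → T (i ∈ᵇ xs) → T (e i))
all⇔ e xs = mk⇔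
  (λ t i i∈xs → Allₗ.lookup (all⁺ e xs t) (from ∈⇔∈ᵇ i∈xs))
  (λ f → all⁻ e {xs = xs} (Allₗ.tabulate λ {i} i∈xs → f i (to ∈⇔∈ᵇ i∈xs)))

-- From 0-based to 1-based positions; true at the junk position 0.
shift : (ℕ → Bool) → ℕ → Bool
shift E zero    = true
shift E (suc i) = E i

merged : List ℕ → List ℕ → ℕ → Bool
merged I J i = (i ∈ᵇ I) ∨ (i ∈ᵇ J) ∨ (suc i ∈ᵇ J)

module _ (E : ℕ → Bool) (I J : List ℕ) where
  private
    E′ E″ : ℕ → Bool
    E′ = shift E
    E″ j = E′ j ∧ E′ (j ∸ 1)

  merged⇒all : (∀ i → T (merged I J (suc i)) → T (E i)) → T (all E′ I ∧ all E″ J)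
  merged⇒all f = from (T-∧ {all E′ I})
    ( from (all⇔ E′ I) (λ i i∈I → f′ i (from (T-∨ {i ∈ᵇ I}) (inj₁ i∈I)))
    , from (all⇔ E″ J) (λ j j∈J → from (T-∧ {E′ j})
        ( f′ j (from (T-∨ {j ∈ᵇ I}) (inj₂ (from (T-∨ {j ∈ᵇ J}) (inj₁ j∈J)))) , prev j j∈J)))
    where
    f′ : ∀ i → T (merged I J i) → T (E′ i)
    f′ zero    _ = tt
    f′ (suc i)   = f i
    prev : ∀ j → T (j ∈ᵇ J) → T (E′ (j ∸ 1))
    prev zero    _   = tt
    prev (suc j) j∈J = f′ j (from (T-∨ {j ∈ᵇ I}) (inj₂ (from (T-∨ {j ∈ᵇ J}) (inj₂ j∈J))))

  all⇒merged : T (all E′ I ∧ all E″ J) → ∀ i → T (merged I J (suc i)) → T (E i)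
  all⇒merged t i m with to (T-∧ {all E′ I}) t
  ... | tI , tJ with to (T-∨ {suc i ∈ᵇ I}) m
  ... | inj₁ ∈I = to (all⇔ E′ I) tI (suc i) ∈I
  ... | inj₂ m′ with to (T-∨ {suc i ∈ᵇ J}) m′
  ... | inj₁ ∈J = proj₁ (to (T-∧ {E i}) (to (all⇔ E″ J) tJ (suc i) ∈J))
  ... | inj₂ ∈J = proj₂ (to (T-∧ {E (suc i)}) (to (all⇔ E″ J) tJ (suc (suc i)) ∈J))

-- Constancy across a union of positions is a conjunction over its members, and overlaps do no harm
-- to Boolean conditions. Each element of J is charged with its predecessor as well, so I and J
-- contribute separately.
compatible-merged : ∀ {m} k (h : Vec ℕ m) I J → let E′ = shift (equalNext k h) in
  compatible (merged I J ∘ suc) k h ≡ all E′ I ∧ all (λ j → E′ j ∧ E′ (j ∸ 1)) J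
compatible-merged k h I J = T-injective (mk⇔
  (merged⇒all _ I J ∘ to (compatible⇔ _ k h)) (from (compatible⇔ _ k h) ∘ all⇒merged _ I J))

-- Summation over signs and over heights

module Expansion {c ℓ : Level} (R : CommutativeRing c ℓ) (q : CommutativeRing.Carrier R) where
  open CommutativeRing R
  open FiniteSums R
  open import Relation.Binary.Reasoning.Setoid setoid
  open import Algebra.Solver.Ring.NaturalCoefficients.Default commutativeSemiring
    using (solve; con; _:+_; _:*_; _:=_)

  1+q : Carrier
  1+q = 1# + q

  q-1 : Carrier
  q-1 = q + - 1#

  -- Sum of q^(number of negative entries) over the admissible ways to put signs
  -- on h, the first entry being constrained by g.
  signSum : ∀ {n} → (ℙ± → Bool) → (ℕ → Bool) → Vec ℕ n → Carrier
  signSum g D []      = 1#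
  signSum g D (k ∷ h) = ind (g (neg k)) * (q * signSum (step (D 0) (neg k)) (D ∘ suc) h)
                      + ind (g (pos k)) * signSum (step (D 0) (pos k)) (D ∘ suc) h

  -- signSum in closed form: b tells whether the step into k is an equality at an
  -- ascent, so that an equality at a descent right after it creates a peak.
  blockWeight : ∀ {n} → Bool → ℕ → Vec ℕ n → (ℕ → Bool) → Carrier
  blockWeight b k []      D = 1#
  blockWeight b k (l ∷ h) D =
    if k <ᵇ l then 1+q * blockWeight false l h (D ∘ suc)
    else if k ≡ᵇ l
      then (if D 0 then (if b then 0# else q * blockWeight false l h (D ∘ suc))
                   else blockWeight true l h (D ∘ suc))
      else 0#

  -- A strict rise opens a new block, which is worth `1+q`. Without a link, the remaining
  -- `ind (k ≡ᵇ l)` is 1 when the block continues and 0 at a forbidden fall.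
  linkWeight : Bool → ℕ → ℕ → Carrier
  linkWeight true  k l = ind (k ≡ᵇ l)
  linkWeight false k l = if k <ᵇ l then 1+q else ind (k ≡ᵇ l)

  linkedWeight : ∀ {n} → (ℕ → Bool) → ℕ → Vec ℕ n → Carrier
  linkedWeight p k []      = 1#
  linkedWeight p k (l ∷ h) = linkWeight (p 0) k l * linkedWeight (p ∘ suc) l h

  unlinked : ℕ → Bool
  unlinked _ = false

  -- At an equality at a descent the first entry must be negative, giving q, and the sign of the
  -- second is free again. At an equality at an ascent the first sign is free and the second entry
  -- must be positive, which leads to `signSum-pos`. After a rise a new block starts with a free
  -- sign.
  signSum-both : ∀ {n} k (h : Vec ℕ n) D →
    q * signSum (step (D 0) (neg k)) (D ∘ suc) h + signSum (step (D 0) (pos k)) (D ∘ suc) h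
      ≈ 1+q * blockWeight false k h D
  -- Once positive, a block can go on only through positive entries at ascents; an equality at a
  -- descent is impossible, whence the 0 in `blockWeight true`.
  signSum-pos : ∀ {n} k (h : Vec ℕ n) D →
    signSum (step (D 0) (pos k)) (D ∘ suc) h ≈ blockWeight true k h D

  private
    1*1* : ∀ x y → 1# * x + 1# * y ≈ x + y
    1*1* x y = +-cong (*-identityˡ x) (*-identityˡ y)

  signSum-both k []      D = trans (+-congʳ (*-identityʳ q)) (trans (+-comm _ _) (sym (*-identityʳ _)))
  signSum-both k (l ∷ h) D with k <ᵇ l | k ≡ᵇ l | D 0
  ... | true  | _     | _     = trans
    (+-cong (*-congˡ (trans (1*1* _ _) (signSum-both l h (D ∘ suc))))
            (trans (1*1* _ _) (signSum-both l h (D ∘ suc))))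
    (solve 2 (λ q y → q :* y :+ y := (con 1 :+ q) :* y) refl q _)
  ... | false | true  | true  = trans
    (+-cong (*-congˡ (trans (1*1* _ _) (signSum-both l h (D ∘ suc))))
            (+-cong (zeroˡ _) (zeroˡ _)))
    (solve 2 (λ q y → q :* ((con 1 :+ q) :* y) :+ (con 0 :+ con 0) := (con 1 :+ q) :* (q :* y)) refl q _)
  ... | false | true  | false = trans
    (+-cong (*-congˡ (trans (+-cong (zeroˡ _) (*-identityˡ _)) (+-congˡ (signSum-pos l h (D ∘ suc)))))
            (+-cong (zeroˡ _) (trans (*-identityˡ _) (signSum-pos l h (D ∘ suc)))))
    (solve 2 (λ q y → q :* (con 0 :+ y) :+ (con 0 :+ y) := (con 1 :+ q) :* y) refl q _)
  ... | false | false | true  =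
    solve 3 (λ q x y → q :* (con 0 :* x :+ con 0 :* y) :+ (con 0 :* x :+ con 0 :* y)
      := (con 1 :+ q) :* con 0) refl q _ _
  ... | false | false | false =
    solve 3 (λ q x y → q :* (con 0 :* x :+ con 0 :* y) :+ (con 0 :* x :+ con 0 :* y)
      := (con 1 :+ q) :* con 0) refl q _ _

  signSum-pos k []      D = refl
  signSum-pos k (l ∷ h) D with k <ᵇ l | k ≡ᵇ l | D 0
  ... | true  | _     | _     = trans (1*1* _ _) (signSum-both l h (D ∘ suc))
  ... | false | true  | true  = trans (+-cong (zeroˡ _) (zeroˡ _)) (+-identityˡ _)
  ... | false | true  | false = trans (+-cong (zeroˡ _) (*-identityˡ _))
    (trans (+-identityˡ _) (signSum-pos l h (D ∘ suc)))
  ... | false | false | true  = trans (+-cong (zeroˡ _) (zeroˡ _)) (+-identityˡ _)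
  ... | false | false | false = trans (+-cong (zeroˡ _) (zeroˡ _)) (+-identityˡ _)

  blockWeight-ascending : ∀ {n} b k (h : Vec ℕ n) D → (∀ i → i ℕ.< n → D i ≡ false) →
    blockWeight b k h D ≈ linkedWeight unlinked k h
  blockWeight-ascending b k []      D asc = refl
  blockWeight-ascending b k (l ∷ h) D asc with k <ᵇ l | k ≡ᵇ l | D 0 | asc 0 z<s
  ... | true  | _     | _     | _ = *-congˡ (blockWeight-ascending false l h (D ∘ suc) (λ i i<n → asc (suc i) (s<s i<n)))
  ... | false | true  | false | _ = trans (blockWeight-ascending true l h (D ∘ suc) (λ i i<n → asc (suc i) (s<s i<n)))
                                      (sym (*-identityˡ _))
  ... | false | false | _     | _ = sym (zeroˡ _)

  module _ (N : ℕ) where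
    open Exponents N

    ∑-valsUpTo : ∀ (f : ℙ± → Carrier) → ∑ (valsUpTo N) f ≈ ∑ (upTo N) (λ k → f (neg k) + f (pos k))
    ∑-valsUpTo f = trans (∑-concatMap _ (upTo N)) (∑-cong (upTo N) λ k → +-congˡ (+-identityʳ _))

    -- `Φ` will be the test for one monomial. It is a parameter because splitting off a first height
    -- k replaces it by `Φ ∘ (bump k a ⊕_)`.
    heightSum : ∀ {n} → (Vec ℕ n → Carrier) → Vec ℕ n → (Vec ℕ N → Carrier) → Carrier
    heightSum {n} w α Φ = ∑ (allVecs (upTo N) n) λ h → w h * Φ (exponent α h)

    ∑-signs : ∀ {n} g D (α : Vec ℕ n) Φ →
      ∑ (allVecs (valsUpTo N) n) (λ v →
        ind (chain g D v) * (powR R q (negatives v) * Φ (exponent α (Vec.map absIdx v))))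
      ≈ heightSum (signSum g D) α Φ
    ∑-signs g D []      Φ = +-congʳ (*-congˡ (*-identityˡ _))
    ∑-signs {suc n} g D (a ∷ α) Φ = begin
      ∑ (allVecs (valsUpTo N) (suc n)) _
        ≈⟨ ∑-allVecs (valsUpTo N) n ⟩
      ∑ (valsUpTo N) _
        ≈⟨ ∑-valsUpTo _ ⟩
      ∑ (upTo N) _
        ≈⟨ ∑-cong (upTo N) (λ k → +-cong (negative k) (positive k)) ⟩
      ∑ (upTo N) (λ k →
          ind (g (neg k)) * (q * heightSum (signSum (step (D 0) (neg k)) (D ∘ suc)) α (Φ ∘ (bump k a ⊕_)))
        + ind (g (pos k)) * heightSum (signSum (step (D 0) (pos k)) (D ∘ suc)) α (Φ ∘ (bump k a ⊕_)))
        ≈⟨ ∑-cong (upTo N) collect ⟩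
      ∑ (upTo N) (λ k → ∑ (allVecs (upTo N) n) λ h → signSum g D (k ∷ h) * Φ (bump k a ⊕ exponent α h))
        ≈⟨ ∑-allVecs (upTo N) n ⟨
      heightSum (signSum g D) (a ∷ α) Φ ∎
      where
      vs = allVecs (valsUpTo N) n
      hs = allVecs (upTo N) n
      negative : ∀ k → ∑ vs (λ v → ind (g (neg k) ∧ chain (step (D 0) (neg k)) (D ∘ suc) v)
          * ((q * powR R q (negatives v)) * Φ (bump k a ⊕ exponent α (Vec.map absIdx v))))
        ≈ ind (g (neg k)) * (q * heightSum (signSum (step (D 0) (neg k)) (D ∘ suc)) α (Φ ∘ (bump k a ⊕_)))
      negative k = begin
        _ ≈⟨ ∑-cong vs (λ v → trans (*-congʳ (ind-∧ (g (neg k)) _))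
               (solve 5 (λ i c q p φ → (i :* c) :* ((q :* p) :* φ) := (i :* q) :* (c :* (p :* φ))) refl _ _ _ _ _)) ⟩
        _ ≈⟨ *-∑ (ind (g (neg k)) * q) vs ⟨
        _ ≈⟨ *-congˡ (∑-signs (step (D 0) (neg k)) (D ∘ suc) α (Φ ∘ (bump k a ⊕_))) ⟩
        _ ≈⟨ *-assoc _ _ _ ⟩
        _ ∎
      positive : ∀ k → ∑ vs (λ v → ind (g (pos k) ∧ chain (step (D 0) (pos k)) (D ∘ suc) v)
          * (powR R q (negatives v) * Φ (bump k a ⊕ exponent α (Vec.map absIdx v))))
        ≈ ind (g (pos k)) * heightSum (signSum (step (D 0) (pos k)) (D ∘ suc)) α (Φ ∘ (bump k a ⊕_))
      positive k = begin
        _ ≈⟨ ∑-cong vs (λ v → trans (*-congʳ (ind-∧ (g (pos k)) _)) (*-assoc _ _ _)) ⟩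
        _ ≈⟨ *-∑ (ind (g (pos k))) vs ⟨
        _ ≈⟨ *-congˡ (∑-signs (step (D 0) (pos k)) (D ∘ suc) α (Φ ∘ (bump k a ⊕_))) ⟩
        _ ∎
      collect : ∀ k →
          ind (g (neg k)) * (q * heightSum (signSum (step (D 0) (neg k)) (D ∘ suc)) α (Φ ∘ (bump k a ⊕_)))
        + ind (g (pos k)) * heightSum (signSum (step (D 0) (pos k)) (D ∘ suc)) α (Φ ∘ (bump k a ⊕_))
        ≈ ∑ hs λ h → signSum g D (k ∷ h) * Φ (bump k a ⊕ exponent α h)
      collect k = begin
        _ ≈⟨ +-cong (trans (sym (*-assoc _ _ _)) (*-∑ _ hs)) (*-∑ _ hs) ⟩
        _ ≈⟨ ∑-+ hs ⟨
        _ ≈⟨ ∑-cong hs (λ h → solve 6 (λ i q s φ j t → (i :* q) :* (s :* φ) :+ j :* (t :* φ)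
               := (i :* (q :* s) :+ j :* t) :* φ) refl _ _ _ _ _ _) ⟩
        _ ∎

    -- The sum over all weakly increasing height sequences starting with k that are
    -- constant across the links p.
    linkedSum : ∀ {m} → (ℕ → Bool) → ℕ → Vec ℕ m → (Vec ℕ N → Carrier) → ℕ → Carrier
    linkedSum p a r Φ k = heightSum (linkedWeight p k) r (Φ ∘ (bump k a ⊕_))

    linkedSum-∷ : ∀ {m} p a b (r : Vec ℕ m) Φ k →
      linkedSum p a (b ∷ r) Φ k ≈
      ∑ (upTo N) (λ l → linkWeight (p 0) k l * linkedSum (p ∘ suc) b r (Φ ∘ (bump k a ⊕_)) l)
    linkedSum-∷ {m} p a b r Φ k = trans (∑-allVecs (upTo N) m)
      (∑-cong (upTo N) λ l → trans (∑-cong (allVecs (upTo N) m) λ h → *-assoc _ _ _)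
        (sym (*-∑ _ (allVecs (upTo N) m))))

    -- A link forces the next height to be k, so the sum over l collapses to one term, in which the
    -- two powers of the same variable unite. The bound on k guarantees that this term occurs.
    linkedSum-merge : ∀ {m} p a (r : Vec ℕ m) Φ {k} → k ℕ.< N →
      linkedSum unlinked (proj₁ (merge p a r)) (fromList (proj₂ (merge p a r))) Φ k ≈ linkedSum p a r Φ k
    linkedSum-merge p a []      Φ k<N = refl
    linkedSum-merge p a (b ∷ r) Φ {k} k<N = trans (head (p 0)) (sym (linkedSum-∷ p a b r Φ k))
      where
      d = proj₁ (merge (p ∘ suc) b r)
      γ = proj₂ (merge (p ∘ suc) b r)
      Φ′ = Φ ∘ (bump k a ⊕_)
      head : ∀ p₀ → let c′ , γ′ = mergeHead p₀ a (d , γ) in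
        linkedSum unlinked c′ (fromList γ′) Φ k ≈
        ∑ (upTo N) (λ l → linkWeight p₀ k l * linkedSum (p ∘ suc) b r Φ′ l)
      head true  = begin
        linkedSum unlinked (a ℕ.+ d) (fromList γ) Φ k
          ≈⟨ ∑-cong (allVecs (upTo N) (length γ)) (λ h → *-congˡ (reflexive (cong Φ (bump-+ k a d (exponent (fromList γ) h))))) ⟩
        linkedSum unlinked d (fromList γ) Φ′ k
          ≈⟨ linkedSum-merge (p ∘ suc) b r Φ′ k<N ⟩
        linkedSum (p ∘ suc) b r Φ′ k
          ≈⟨ ∑-upTo-δ N (linkedSum (p ∘ suc) b r Φ′) k<N ⟨
        ∑ (upTo N) (λ l → ind (k ≡ᵇ l) * linkedSum (p ∘ suc) b r Φ′ l) ∎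
      head false = trans (linkedSum-∷ unlinked a d (fromList γ) Φ k)
        (∑-cong-All (all-upTo N) λ l<N → *-congˡ (linkedSum-merge (p ∘ suc) b r Φ′ l<N))

    -- The coefficients of U and η as sums over heights

    module _ (e : Vec ℕ N) where

      atExponent : Vec ℕ N → Carrier
      atExponent m = ind (does (Vecₚ.≡-dec ℕ._≟_ m e))

      U≈heightSum : ∀ {n} (π : Permutation′ n) (α : Vec ℕ n) →
        U R q π α N e ≈ heightSum (signSum anyValue (descent (word π))) α atExponent
      U≈heightSum {n} π α = begin
        U R q π α N e
          -- Passing from values listed by label to values listed along the word turns the poset
          -- condition into a condition on neighbours.
          ≈⟨ ∑-reindex (valsUpTo N) n π ⟩
        _
          ≈⟨ ∑-cong (allVecs (valsUpTo N) n) (λ v → trans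
               (reflexive (cong₃ (enriched?≡chain π v) (monomial v) (signs v)))
               (value≈ (chain anyValue (descent (word π)) v) (exponent α (Vec.map absIdx v)) (negatives v))) ⟩
        ∑ (allVecs (valsUpTo N) n) (λ v → ind (chain anyValue (descent (word π)) v)
          * (powR R q (negatives v) * atExponent (exponent α (Vec.map absIdx v))))
          ≈⟨ ∑-signs anyValue (descent (word π)) α atExponent ⟩
        heightSum (signSum anyValue (descent (word π))) α atExponent ∎
        where
        value : Bool → Vec ℕ N → ℕ → Carrier
        value b m s = if b ∧ does (Vecₚ.≡-dec ℕ._≟_ m e) then powR R q s else 0#
        cong₃ : ∀ {b b′ m m′ s s′} → b ≡ b′ → m ≡ m′ → s ≡ s′ → value b m s ≡ value b′ m′ s′
        cong₃ ≡.refl ≡.refl ≡.refl = ≡.refl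
        value≈ : ∀ b m s → value b m s ≈ ind b * (powR R q s * atExponent m)
        value≈ b m s = trans (if≈ind (b ∧ _)) (trans (*-congʳ (ind-∧ b _))
          (trans (*-assoc _ _ _) (*-congˡ (*-comm _ _))))
        signs : ∀ v → negatives (reindex π v) ≡ negatives v
        signs v = ≡.trans
          (cong Vec.sum (Vecₚ.tabulate-cong {n = n} λ a →
            cong (λ x → if isNegᵇ x then 1 else 0) (Vecₚ.lookup∘tabulate (λ a → lookup v (π ⟨$⟩ˡ a)) a)))
          (sum-permute π (λ i → if isNegᵇ (lookup v i) then 1 else 0))
        monomial : ∀ v → tabulate (λ j → Vec.sum (tabulate λ a →
            if absIdx (lookup (reindex π v) a) ≡ᵇ toℕ j then lookup α (π ⟨$⟩ˡ a) else 0))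
          ≡ exponent α (Vec.map absIdx v)
        monomial v = ≡.trans (Vecₚ.tabulate-cong λ j → ≡.trans
          (cong Vec.sum (Vecₚ.tabulate-cong λ a → cong (λ k → if k ≡ᵇ toℕ j then lookup α (π ⟨$⟩ˡ a) else 0)
            (≡.trans (cong absIdx (Vecₚ.lookup∘tabulate _ a)) (≡.sym (Vecₚ.lookup-map (π ⟨$⟩ˡ a) absIdx v)))))
          (sum-permute π (λ i → if lookup (Vec.map absIdx v) i ≡ᵇ toℕ j then lookup α i else 0)))
          (exponent-tabulate α (Vec.map absIdx v))

      -- No rise precedes the first block, so its factor `1+q` is not part of `blockWeight` and
      -- stands in front; no step precedes it either, whence the flag `false`.
      U≈blockSum : ∀ {m} (π : Permutation′ (suc m)) a (r : Vec ℕ m) →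
        U R q π (a ∷ r) N e ≈ ∑ (upTo N) (λ k →
          1+q * heightSum (λ h → blockWeight false k h (descent (word π))) r (atExponent ∘ (bump k a ⊕_)))
      U≈blockSum {m} π a r = begin
        U R q π (a ∷ r) N e
          ≈⟨ U≈heightSum π (a ∷ r) ⟩
        heightSum (signSum anyValue D) (a ∷ r) atExponent
          ≈⟨ ∑-allVecs (upTo N) m ⟩
        ∑ (upTo N) (λ k → heightSum (λ h → signSum anyValue D (k ∷ h)) r (atExponent ∘ (bump k a ⊕_)))
          ≈⟨ ∑-cong (upTo N) (λ k → trans
               (∑-cong (allVecs (upTo N) m) λ h → trans
                 (*-congʳ (trans (1*1* _ _) (signSum-both k h D))) (*-assoc _ _ _))
               (sym (*-∑ 1+q (allVecs (upTo N) m)))) ⟩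
        ∑ (upTo N) _ ∎
        where D = descent (word π)

      η≈linkedSum : ∀ c γ →
        η R q (c ∷ γ) N e ≈ ∑ (upTo N) (λ k → 1+q * linkedSum unlinked c (fromList γ) atExponent k)
      η≈linkedSum c γ = trans (U≈blockSum Perm.id c (fromList γ))
        (∑-cong (upTo N) λ k → *-congˡ (∑-cong (allVecs (upTo N) _) λ h →
          *-congʳ (blockWeight-ascending false k h _ ascending)))
        where
        n = suc (length γ)
        word-id : ∀ i → i ℕ.< n → word {n} Perm.id i ≡ suc i
        word-id i i<n = ≡.subst (λ j → word {n} Perm.id j ≡ suc j) (toℕ-fromℕ< i<n) (word-toℕ Perm.id (Fin.fromℕ< i<n))
        ascending : ∀ i → i ℕ.< length γ → descent (word {n} Perm.id) i ≡ false
        ascending i i<l rewrite word-id i (ℕₚ.m<n⇒m<1+n i<l) | word-id (suc i) (s<s i<l) = n<ᵇ i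
          where
          n<ᵇ : ∀ i → (suc i <ᵇ i) ≡ false
          n<ᵇ zero    = ≡.refl
          n<ᵇ (suc i) = n<ᵇ i

      η-merge : ∀ {m} a (r : Vec ℕ m) I J →
        η R q ((a ∷ toList r) ↓ I ↓↓ J) N e ≈
        ∑ (upTo N) (λ k → 1+q * linkedSum (merged I J ∘ suc) a r atExponent k)
      η-merge a r I J = begin
        η R q ((a ∷ toList r) ↓ I ↓↓ J) N e
          ≈⟨ reflexive (cong (λ β → η R q β N e) (↓set≡merge (merged I J) a r)) ⟩
        η R q (cons (merge (merged I J ∘ suc) a r)) N e
          ≈⟨ η≈linkedSum (proj₁ (merge (merged I J ∘ suc) a r)) (proj₂ (merge (merged I J ∘ suc) a r)) ⟩
        _
          ≈⟨ ∑-cong-All (all-upTo N) (λ k<N → *-congˡ (linkedSum-merge (merged I J ∘ suc) a r atExponent k<N)) ⟩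
        _ ∎

-- Summation over the pairs (I , J)

module PeakExpansion {c ℓ : Level} (R : CommutativeRing c ℓ) (q : CommutativeRing.Carrier R) where
  open CommutativeRing R
  open FiniteSums R
  open Expansion R q
  open import Relation.Binary.Reasoning.Setoid setoid
  open import Algebra.Solver.Ring.NaturalCoefficients.Default commutativeSemiring
    using (solve; _:*_; _:=_)

  -- Distributes the scalars and the constancy conditions over the elements of I or J, as
  -- `∑-disjoint-sublists` requires.
  powR-all : ∀ x (e : ℕ → Bool) L → powR R x (length L) * ind (all e L) ≈ ∏ L (λ i → x * ind (e i))
  powR-all x e []      = *-identityˡ 1#
  powR-all x e (i ∷ L) = trans (*-congˡ (ind-∧ (e i) (all e L)))
    (trans (solve 4 (λ x p i a → (x :* p) :* (i :* a) := (x :* i) :* (p :* a)) refl _ _ _ _)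
      (*-congˡ (powR-all x e L)))

  <ᵇ⇒≡ᵇ-false : ∀ k l → (k <ᵇ l) ≡ true → (k ≡ᵇ l) ≡ false
  <ᵇ⇒≡ᵇ-false zero    (suc l) _  = ≡.refl
  <ᵇ⇒≡ᵇ-false (suc k) (suc l) eq = <ᵇ⇒≡ᵇ-false k l eq

  linkWeight-ind : ∀ p k l → linkWeight p k l ≈ ind (not p ∨ (k ≡ᵇ l)) * linkWeight false k l
  linkWeight-ind false k l = sym (*-identityˡ _)
  linkWeight-ind true  k l with k <ᵇ l | k ≡ᵇ l | <ᵇ⇒≡ᵇ-false k l
  ... | true  | true  | f = contradiction (f ≡.refl) λ ()
  ... | true  | false | _ = sym (zeroˡ _)
  ... | false | true  | _ = sym (*-identityˡ _)
  ... | false | false | _ = sym (zeroˡ _)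

  -- A link only discards height sequences, never reweights them: wherever the link holds, there is
  -- no rise and the weight of the step is 1 in either case. The choice of (I , J) thus enters
  -- through an indicator alone.
  linkedWeight-compatible : ∀ {m} p k (h : Vec ℕ m) →
    linkedWeight p k h ≈ ind (compatible p k h) * linkedWeight unlinked k h
  linkedWeight-compatible p k []      = sym (*-identityˡ _)
  linkedWeight-compatible p k (l ∷ h) = begin
    linkWeight (p 0) k l * linkedWeight (p ∘ suc) l h
      ≈⟨ *-cong (linkWeight-ind (p 0) k l) (linkedWeight-compatible (p ∘ suc) l h) ⟩
    (ind (not (p 0) ∨ (k ≡ᵇ l)) * linkWeight false k l) * (ind (compatible (p ∘ suc) l h) * linkedWeight unlinked l h)
      ≈⟨ solve 4 (λ i w j v → (i :* w) :* (j :* v) := (i :* j) :* (w :* v)) refl _ _ _ _ ⟩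
    (ind (not (p 0) ∨ (k ≡ᵇ l)) * ind (compatible (p ∘ suc) l h)) * linkedWeight unlinked k (l ∷ h)
      ≈⟨ *-congʳ (ind-∧ (not (p 0) ∨ (k ≡ᵇ l)) (compatible (p ∘ suc) l h)) ⟨
    ind (compatible p k (l ∷ h)) * linkedWeight unlinked k (l ∷ h) ∎

  stepFactor : (b δ ε : Bool) → Carrier
  stepFactor b δ ε = if δ ∧ ε then (if b then 0# else q) else 1#

  stepFactors : Bool → (D E : ℕ → Bool) → ℕ → Carrier
  stepFactors b D E zero    = stepFactor b (D 0) (E 0)
  stepFactors b D E (suc i) = stepFactors (not (D 0) ∧ E 0) (D ∘ suc) (E ∘ suc) i

  -- The flag is renewed at every step from that step alone, so each later factor sees just two
  -- neighbouring steps, as a peak does.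
  stepFactors-suc : ∀ b D E i →
    stepFactors b D E (suc i) ≡ stepFactor (not (D i) ∧ E i) (D (suc i)) (E (suc i))
  stepFactors-suc b D E zero    = ≡.refl
  stepFactors-suc b D E (suc i) = stepFactors-suc (not (D 0) ∧ E 0) (D ∘ suc) (E ∘ suc) i

  -- At a rise there is no equality, so the local factor is 1 and `linkedWeight` supplies `1+q`; at
  -- a fall both sides vanish. The local factor differs from 1 only at an equality at a descent.
  ∏-stepFactors : ∀ {m} b k (h : Vec ℕ m) D →
    ∏ (upTo m) (stepFactors b D (equalNext k h)) * linkedWeight unlinked k h ≈ blockWeight b k h D
  ∏-stepFactors b k [] D = *-identityˡ 1#
  ∏-stepFactors {suc m} b k (l ∷ h) D = trans (*-congʳ (∏-upTo-suc m (stepFactors b D (equalNext k (l ∷ h))))) head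
    where
    regroup : ∀ f p w v → (f * p) * (w * v) ≈ f * (w * (p * v))
    regroup = solve 4 (λ f p w v → (f :* p) :* (w :* v) := f :* (w :* (p :* v))) refl
    atDescent : ∀ b {p v x} → p * v ≈ x →
      ((if b then 0# else q) * p) * (1# * v) ≈ (if b then 0# else q * x)
    atDescent true  _     = trans (*-congʳ (zeroˡ _)) (zeroˡ _)
    atDescent false pv≈x  = trans (regroup _ _ _ _) (*-congˡ (trans (*-identityˡ _) pv≈x))
    tail : ∀ b → _
    tail b = ∏-stepFactors b l h (D ∘ suc)
    head : (stepFactor b (D 0) (k ≡ᵇ l) * ∏ (upTo m) (stepFactors (not (D 0) ∧ (k ≡ᵇ l)) (D ∘ suc) (equalNext l h)))
      * (linkWeight false k l * linkedWeight unlinked l h) ≈ blockWeight b k (l ∷ h) D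
    -- Once abstracted, the two comparisons are unrelated Booleans; `<ᵇ⇒≡ᵇ-false` excludes that both
    -- hold.
    head with k <ᵇ l | k ≡ᵇ l | <ᵇ⇒≡ᵇ-false k l | D 0
    ... | true  | true  | f | _     = contradiction (f ≡.refl) λ ()
    ... | true  | false | _ | true  = trans (regroup _ _ _ _) (trans (*-identityˡ _) (*-congˡ (tail false)))
    ... | true  | false | _ | false = trans (regroup _ _ _ _) (trans (*-identityˡ _) (*-congˡ (tail false)))
    ... | false | true  | _ | false = trans (regroup _ _ _ _)
      (trans (*-identityˡ _) (trans (*-identityˡ _) (tail true)))
    ... | false | false | _ | true  = trans (*-congˡ (zeroˡ _)) (zeroʳ _)
    ... | false | false | _ | false = trans (*-congˡ (zeroˡ _)) (zeroʳ _)
    ... | false | true  | _ | true  = atDescent b (tail false)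

  1+0+0 : ∀ {x y} → x ≈ 0# → y ≈ 0# → 1# + x + y ≈ 1#
  1+0+0 x≈0 y≈0 = trans (+-cong (trans (+-congˡ x≈0) (+-identityʳ 1#)) y≈0) (+-identityʳ 1#)

  1+[q-1] : 1# + 1# * (q-1 * 1#) ≈ q
  1+[q-1] = trans (+-congˡ (trans (*-identityˡ _) (*-identityʳ _)))
    (trans (+-comm _ _) (trans (+-assoc _ _ _) (trans (+-congˡ (-‿inverseˡ 1#)) (+-identityʳ q))))

  -- At a descent that is an equality, the three ways to place the position
  -- (nowhere, in I, in J) contribute 1 + (q - 1) - q = 0 at a peak and
  -- 1 + (q - 1) = q otherwise.
  choices : ∀ β δ ε ε′ →
    1# + ind δ * (q-1 * ind ε) + ind (β ∧ δ) * (- q * ind (ε ∧ ε′)) ≈ stepFactor (β ∧ ε′) δ ε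
  choices false false ε     ε′    = 1+0+0 (zeroˡ _) (zeroˡ _)
  choices true  false ε     ε′    = 1+0+0 (zeroˡ _) (zeroˡ _)
  choices β     true  false ε′    =
    1+0+0 (trans (*-congˡ (zeroʳ _)) (zeroʳ _)) (trans (*-congˡ (zeroʳ _)) (zeroʳ _))
  choices false true  true  ε′    = trans (+-cong 1+[q-1] (zeroˡ _)) (+-identityʳ q)
  choices true  true  true  false =
    trans (+-cong 1+[q-1] (trans (*-congˡ (zeroʳ _)) (zeroʳ _))) (+-identityʳ q)
  choices true  true  true  true  =
    trans (+-cong 1+[q-1] (trans (*-identityˡ _) (*-identityʳ _))) (-‿inverseʳ q)

  coefficient : List ℕ → List ℕ → Carrier
  coefficient I J = powR R (- q) (length J) * powR R q-1 (length I)

  module _ {m : ℕ} (π : Permutation′ (suc m)) where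

    private
      D = descent (word π)
      isDes isPeak : ℕ → Bool
      isDes i = oneLine π (suc i) <ᵇ oneLine π i
      isPeak i = (2 ℕ.≤ᵇ i) ∧ (oneLine π (i ∸ 1) <ᵇ oneLine π i) ∧ (oneLine π (suc i) <ᵇ oneLine π i)

    ∑-DesPeakPairs : ∀ (F : List ℕ × List ℕ → Carrier) → ∑ (DesPeakPairs π) F ≈
      ∑ (sublists (Des π)) λ I → ∑ (sublists (Peak π)) λ J → ind (disjointᵇ I J) * F (I , J)
    ∑-DesPeakPairs F = trans (∑-filterᵇ _ (concatMap _ (sublists (Des π))))
      (trans (∑-concatMap _ (sublists (Des π)))
        (∑-cong (sublists (Des π)) λ I → ∑-map (I ,_) (sublists (Peak π))))

    -- The weight `w` without links is common to all pairs. With it pulled out, every position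
    -- independently lies in I, in J or in neither, and the sum becomes a product of local factors.
    ∑-linkedWeight : ∀ k (h : Vec ℕ m) →
      ∑ (DesPeakPairs π) (λ (I , J) → coefficient I J * linkedWeight (merged I J ∘ suc) k h)
      ≈ blockWeight false k h D
    ∑-linkedWeight k h = begin
      _ ≈⟨ ∑-DesPeakPairs _ ⟩
      _ ≈⟨ ∑-cong (sublists (Des π)) (λ I → trans (∑-cong (sublists (Peak π)) (term I))
             (sym (∑-* (sublists (Peak π)) w))) ⟩
      _ ≈⟨ ∑-* (sublists (Des π)) w ⟨
      _ ≈⟨ *-congʳ (∑-disjoint-sublists a b isDes isPeak (Unique.map⁺ ℕₚ.suc-injective (Unique.upTo⁺ m))) ⟩
      _ ≈⟨ *-congʳ (∏-map suc (upTo m)) ⟩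
      _ ≈⟨ *-congʳ (∏-cong-All (all-upTo m) (λ {i} → factor i)) ⟩
      _ ≈⟨ ∏-stepFactors false k h D ⟩
      _ ∎
      where
      E = equalNext k h
      E′ = shift E
      E″ : ℕ → Bool
      E″ j = E′ j ∧ E′ (j ∸ 1)
      w = linkedWeight unlinked k h
      a b : ℕ → Carrier
      a i = q-1 * ind (E′ i)
      b j = - q * ind (E″ j)
      term : ∀ I J → ind (disjointᵇ I J) * (coefficient I J * linkedWeight (merged I J ∘ suc) k h)
        ≈ (ind (disjointᵇ I J) * (∏ J b * ∏ I a)) * w
      term I J = begin
        _ ≈⟨ *-congˡ (*-congˡ (trans (linkedWeight-compatible (merged I J ∘ suc) k h)
               (*-congʳ (trans (reflexive (cong ind (compatible-merged k h I J))) (ind-∧ (all E′ I) (all E″ J)))))) ⟩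
        _ ≈⟨ solve 6 (λ d x y i j v → d :* ((x :* y) :* ((i :* j) :* v)) := (d :* ((x :* j) :* (y :* i))) :* v)
               refl _ _ _ _ _ _ ⟩
        _ ≈⟨ *-congʳ (*-congˡ (*-cong (powR-all (- q) E″ J) (powR-all q-1 E′ I))) ⟩
        _ ∎
      factor : ∀ i → i ℕ.< m → 1# + ind (isDes (suc i)) * a (suc i) + ind (isPeak (suc i)) * b (suc i)
        ≈ stepFactors false D E i
      -- Position 1 is never a peak, so β is `false`; the final `true` is the value of `shift E` at
      -- 0.
      factor zero    _   = choices false (D 0) (E 0) true
      -- With the ascent on the left rewritten as a failed descent, `not (D i) ∧ E i` is exactly the
      -- flag carried by `stepFactors`.
      factor (suc i) i<m = trans
        (+-congˡ (*-congʳ (reflexive (cong (λ β → ind (β ∧ D (suc i))) (word-flip π i (ℕₚ.<-trans i<m (ℕₚ.n<1+n m)))))))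
        (trans (choices (not (D i)) (D (suc i)) (E (suc i)) (E i))
          (reflexive (≡.sym (stepFactors-suc false D E i))))

    peakExpansion : ∀ (α : Vec ℕ (suc m)) N e →
      U R q π α N e ≈ ∑ (DesPeakPairs π) (λ (I , J) → coefficient I J * η R q (toList α ↓ I ↓↓ J) N e)
    peakExpansion (a ∷ r) N e = sym (begin
      ∑ pairs (λ (I , J) → coefficient I J * η R q ((a ∷ toList r) ↓ I ↓↓ J) N e)
        ≈⟨ ∑-cong pairs (λ (I , J) → trans (*-congˡ (η-merge N e a r I J)) (*-∑ _ (upTo N))) ⟩
      ∑ pairs (λ (I , J) → ∑ (upTo N) λ k → coefficient I J * (1+q * linkedSum N (merged I J ∘ suc) a r Φ k))
        ≈⟨ ∑-swap pairs (upTo N) ⟩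
      ∑ (upTo N) (λ k → ∑ pairs λ (I , J) → coefficient I J * (1+q * linkedSum N (merged I J ∘ suc) a r Φ k))
        ≈⟨ ∑-cong (upTo N) collect ⟩
      ∑ (upTo N) (λ k → 1+q * heightSum N (λ h → blockWeight false k h D) r (Φ ∘ (bump k a ⊕_)))
        ≈⟨ U≈blockSum N e π a r ⟨
      U R q π (a ∷ r) N e ∎)
      where
      open Exponents N
      pairs = DesPeakPairs π
      hs = allVecs (upTo N) m
      Φ = atExponent N e
      collect : ∀ k → ∑ pairs (λ (I , J) → coefficient I J * (1+q * linkedSum N (merged I J ∘ suc) a r Φ k))
        ≈ 1+q * heightSum N (λ h → blockWeight false k h D) r (Φ ∘ (bump k a ⊕_))
      collect k = begin
        ∑ pairs (λ (I , J) → coefficient I J * (1+q * linkedSum N (merged I J ∘ suc) a r Φ k))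
          ≈⟨ ∑-cong pairs (λ (I , J) → trans (*-swap _ _ _) (*-congˡ (trans (*-∑ _ hs)
               (∑-cong hs λ h → sym (*-assoc _ _ _))))) ⟩
        ∑ pairs (λ (I , J) → 1+q * ∑ hs λ h → summand I J h)
          ≈⟨ *-∑ 1+q pairs ⟨
        1+q * ∑ pairs (λ (I , J) → ∑ hs λ h → summand I J h)
          ≈⟨ *-congˡ (∑-swap pairs hs) ⟩
        1+q * ∑ hs (λ h → ∑ pairs λ (I , J) → summand I J h)
          ≈⟨ *-congˡ (∑-cong hs λ h → trans (sym (∑-* pairs _)) (*-congʳ (∑-linkedWeight k h))) ⟩
        1+q * heightSum N (λ h → blockWeight false k h D) r (Φ ∘ (bump k a ⊕_)) ∎
        where
        summand : List ℕ → List ℕ → Vec ℕ m → Carrier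
        summand I J h = (coefficient I J * linkedWeight (merged I J ∘ suc) k h) * Φ (bump k a ⊕ exponent r h)

theorem3p4 : ∀ {c ℓ : Level} (R : CommutativeRing c ℓ) (q : CommutativeRing.Carrier R)
    (n : ℕ) (π : Permutation′ n) (α : Vec ℕ n) → All (1 ≤_) α →
    _≈ₛ_ R (U R q π α)
    (sumₛ R (map (λ { (I , J) →
    _·ₛ_ R (CommutativeRing._*_ R
    (powR R (CommutativeRing.-_ R q) (length J))
    (powR R (CommutativeRing._+_ R q (CommutativeRing.-_ R (CommutativeRing.1# R))) (length I)))
    (η R q (toList α ↓ I ↓↓ J)) })
    (DesPeakPairs π)))
theorem3p4 R q zero π [] _ N e = begin
  -- The only pair is ([] , []), and both permutations of the empty set give the same sum because
  -- `signSum` of the empty vector ignores the descents.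
  U R q π [] N e                      ≈⟨ U≈heightSum N e π [] ⟩
  _                                   ≈⟨ U≈heightSum N e Perm.id [] ⟨
  η R q [] N e                        ≈⟨ *-identityˡ _ ⟨
  1# * η R q [] N e                   ≈⟨ *-congʳ (*-identityˡ 1#) ⟨
  (1# * 1#) * η R q [] N e            ≈⟨ +-identityʳ _ ⟨
  (1# * 1#) * η R q [] N e + 0#       ∎
  where
  open CommutativeRing R
  open Expansion R q
  open import Relation.Binary.Reasoning.Setoid setoid
theorem3p4 R q (suc m) π α _ N e = trans (peakExpansion π α N e)
  (sym (∑-map _ (DesPeakPairs π)))
  where
  open CommutativeRing R
  open FiniteSums R
  open PeakExpansion R q
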